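{- Let $n \ge 2$ be an integer and let $p_0, p_1$ be positive integers. Then there exists a convex $n$-dimensional rational polytope $\mathcal{P} \subset \mathbb{R}^n$ whose period sequence is $(p_0, p_1, 1, \dotsc, 1)$; that is, in its Ehrhart quasi-polynomial $\sum_{i=0}^{n} c_i(t)\,t^i$, the coefficient function $c_0$ has minimum period $p_0$, $c_1$ has minimum period $p_1$, and $c_i$ is constant for $2 \le i \le n$.
   Context: A rational polytope is a polytope all of whose vertices have rational coordinates. For an $n$-dimensional rational polytope $\mathcal{P} \subset \mathbb{R}^n$, the Ehrhart function $\mathrm{ehr}_{\mathcal{P}}(k) = |k\mathcal{P} \cap \mathbb{Z}^n|$ ($k \in \mathbb{Z}_{\ge 1}$) is a quasi-polynomial: $\mathrm{ehr}_{\mathcal{P}}(k) = \sum_{i=0}^n c_i(k) k^i$ for all integers $k \ge 1$, where each $c_i \colon \mathbb{Z} \to \mathbb{Q}$ is periodic (these coefficient functions are uniquely determined). The period sequence of $\mathcal{P}$ is $(p_0, \dotsc, p_n)$, where $p_i$ is the minimum positive integer with $c_i(k) = c_i(k+p_i)$ for all $k \in \mathbb{Z}$. -}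

module Defs where

open import Data.Nat as ℕ using (ℕ; zero; suc)
open import Data.Integer as ℤ using (ℤ; +_)
open import Data.Rational using (ℚ; 0ℚ; 1ℚ; _+_; _*_; _-_; _≤_; _/_)
open import Data.Fin using (Fin; zero; suc)
open import Data.Product using (Σ; ∃; _×_; _,_)
open import Relation.Binary.PropositionalEquality using (_≡_)
open import Relation.Nullary using (¬_)

Pt : ℕ → Set
Pt n = Fin n → ℚ

ZPt : ℕ → Set
ZPt n = Fin n → ℤ

ℤ→ℚ : ℤ → ℚ
ℤ→ℚ z = z / 1

ℕ→ℚ : ℕ → ℚ
ℕ→ℚ k = (+ k) / 1

sumℚ : {m : ℕ} → (Fin m → ℚ) → ℚ
sumℚ {zero}  f = 0ℚ
sumℚ {suc m} f = f zero + sumℚ (λ i → f (suc i))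

_^ℚ_ : ℚ → ℕ → ℚ
x ^ℚ zero  = 1ℚ
x ^ℚ suc i = x * (x ^ℚ i)

-- A rational polytope in ℝ^n, given as the convex hull of finitely many
-- rational points (its vertex set, or any finite generating set).
record RatPolytope (n : ℕ) : Set where
  constructor polytope
  field
    m     : ℕ
    verts : Fin m → Pt n
open RatPolytope public

-- x ∈ k·P : x = k · Σ λ_j v_j with λ_j ≥ 0, Σ λ_j = 1.
-- (For rational x and rational vertices, rational coefficients λ exist
--  whenever real ones do, so this is the usual convex hull membership.)
InDilate : {n : ℕ} → RatPolytope n → ℕ → Pt n → Set
InDilate {n} P k x =
  Σ (Fin (m P) → ℚ) λ lam →
    (∀ j → 0ℚ ≤ lam j) × (sumℚ lam ≡ 1ℚ) ×
    (∀ (c : Fin n) → x c ≡ ℕ→ℚ k * sumℚ (λ j → lam j * verts P j c))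

_≗ᶻ_ : {n : ℕ} → ZPt n → ZPt n → Set
z ≗ᶻ w = ∀ c → z c ≡ w c

LatticeCount : {n : ℕ} → RatPolytope n → ℕ → ℕ → Set
LatticeCount {n} P k N =
  Σ (Fin N → ZPt n) λ f →
    (∀ i → InDilate P k (λ c → ℤ→ℚ (f i c))) ×
    (∀ i j → f i ≗ᶻ f j → i ≡ j) ×
    (∀ (z : ZPt n) → InDilate P k (λ c → ℤ→ℚ (z c)) → ∃ λ i → f i ≗ᶻ z)

FullDim : {n : ℕ} → RatPolytope n → Set
FullDim {n} P =
  Σ (Fin (suc n) → Fin (m P)) λ a →
    ∀ (μ : Fin n → ℚ) →
      (∀ (c : Fin n) →
        sumℚ (λ i → μ i * (verts P (a (suc i)) c - verts P (a zero) c)) ≡ 0ℚ) →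
      ∀ i → μ i ≡ 0ℚ

MinPeriod : (ℤ → ℚ) → ℕ → Set
MinPeriod f p =
  (1 ℕ.≤ p) ×
  (∀ (t : ℤ) → f (t ℤ.+ + p) ≡ f t) ×
  (∀ (q : ℕ) → 1 ℕ.≤ q → q ℕ.< p → ¬ (∀ (t : ℤ) → f (t ℤ.+ + q) ≡ f t))

EhrhartQP : {n : ℕ} → RatPolytope n → (Fin (suc n) → ℤ → ℚ) → Set
EhrhartQP {n} P c =
  ∀ (k : ℕ) → 1 ℕ.≤ k →
    Σ ℕ λ N → LatticeCount P k N ×
      (ℕ→ℚ N ≡ sumℚ (λ i → c i (+ k) * (ℕ→ℚ k ^ℚ Data.Fin.toℕ i)))

PeriodSeq01 : {n : ℕ} → (Fin (suc n) → ℤ → ℚ) → ℕ → ℕ → Set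
PeriodSeq01 {n} c p₀ p₁ =
  MinPeriod (c zero) p₀ ×
  ((i : Fin n) → MinPeriod (c (suc i)) (pick i))
  where
    pick : Fin n → ℕ
    pick zero    = p₁
    pick (suc _) = 1

{-# OPTIONS --safe #-}
module Submission where

-- Write p₀ = 1 + π and p₁ = 1 + δ.  Take the polygon
--   Q = {(x, y) : 0 ≤ x ≤ 1 + δ, lower(x) ≤ y ≤ upper(x)},
-- where upper has slopes 1/p₁ and 1/p₁ − 1 to the left and to the right of x = 1, and lower
-- has slopes 1/p₀ − 1 and 0 there.  Shearing the right half, the upper boundary becomes one
-- lattice segment of slope 1/p₁, so it contributes a polynomial to the Ehrhart function; the
-- lower left edge contributes Σ_{s ≤ k} ⌊s/p₀⌋, hence a constant term of period p₀ and
-- nothing else that is periodic.  Cutting Q along x = 1 and inserting a unit prism adds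
-- k · (⌊k/p₁⌋ + linear), which puts the period p₁ into the linear coefficient alone.
-- In higher dimension the pyramid over Q is cut and prolonged in the same way: the counts of Q
-- and of its section x = 1 are replaced by their partial sums, and summation preserves
-- "polynomial plus periodic, of minimum period p".

open import Defs
import Algebra.Properties.AbelianGroup as AbelianGroupProperties
open import Data.Fin as Fin using (Fin; zero; suc)
import Data.Fin.Properties as Finₚ
open import Data.Integer as ℤ using (ℤ; +_; -[1+_])
import Data.Integer.Properties as ℤₚ
open import Data.Maybe.Base using (Maybe; just; nothing)
open import Data.Nat as ℕ using (ℕ; zero; suc; _∸_)
import Data.Nat.Coprimality as Coprimality
open import Data.Nat.Divisibility using (n∣m*n)
import Data.Nat.DivMod as DivMod
import Data.Nat.Properties as ℕₚ
open import Data.Nat.Tactic.RingSolver using () renaming (solve-∀ to ring-ℕ)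
open import Data.Product using (Σ; ∃; _×_; _,_; proj₁; proj₂)
open import Data.Rational as ℚ using (ℚ; mkℚ; 0ℚ; 1ℚ; _+_; _*_; _-_; -_; _≤_; *≤*)
import Data.Rational.Properties as ℚₚ
open import Data.Sum using (_⊎_; inj₁; inj₂; [_,_]′)
open import Data.Vec as Vec using (Vec)
open import Data.Vec.Functional using (_∷_; []; tail)
open import Function using (_∘_)
open import Level using (0ℓ)
open import Relation.Binary.PropositionalEquality hiding (J)
open import Relation.Nullary using (¬_; yes; no; contradiction)
open import Tactic.RingSolver using (solve-∀)
open import Tactic.RingSolver.Core.AlmostCommutativeRing using (AlmostCommutativeRing; fromCommutativeRing)

private
  module ℤ-group = AbelianGroupProperties ℤₚ.+-0-abelianGroup
  module ℚ-group = AbelianGroupProperties ℚₚ.+-0-abelianGroup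

-- The cut sits at x = 1 because there the upper boundary of Q is highest and the lower one lowest:
-- inserting a prism at that place is the Minkowski sum of Q with a horizontal segment, so convexity
-- survives. Such sums also slice well. In the k-th dilate the slice at height a is (k - a)Q plus a
-- segment of length k, whatever a is, so the number of inserted columns is k in every slice. If the
-- inserted length shrank along with the slice, the periodic count of the section would be summed
-- with a varying factor, and the period p₁ would leak into the constant coefficient. The width 1 +
-- δ and the height δ at x = 0 are chosen for the shear: adding x - 1 on the right half turns the
-- upper boundary into the segment from (0, δ) to (p₁, p₁), whose ends are lattice points, while the
-- unsheared right end stays at height 1, so that every column contains y = 0.

ℚ-ring : AlmostCommutativeRing 0ℓ 0ℓ
ℚ-ring = fromCommutativeRing ℚₚ.+-*-commutativeRing isZero
  where
  isZero : ∀ x → Maybe (0ℚ ≡ x)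
  isZero x with 0ℚ ℚₚ.≟ x
  ... | yes p = just p
  ... | no _ = nothing

-- Integers and natural numbers inside ℚ

ℤ→ℚ-mkℚ : ∀ z → ℤ→ℚ z ≡ mkℚ z 0 (Coprimality.sym (Coprimality.1-coprimeTo ℤ.∣ z ∣))
ℤ→ℚ-mkℚ z = ℚₚ.↥p/↧p≡p (mkℚ z 0 (Coprimality.sym (Coprimality.1-coprimeTo ℤ.∣ z ∣)))

ℤ→ℚ-+ : ∀ a b → ℤ→ℚ (a ℤ.+ b) ≡ ℤ→ℚ a + ℤ→ℚ b
ℤ→ℚ-+ a b = sym (trans (cong₂ _+_ (ℤ→ℚ-mkℚ a) (ℤ→ℚ-mkℚ b))
                       (cong ℤ→ℚ (cong₂ ℤ._+_ (ℤₚ.*-identityʳ a) (ℤₚ.*-identityʳ b))))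

ℤ→ℚ-* : ∀ a b → ℤ→ℚ (a ℤ.* b) ≡ ℤ→ℚ a * ℤ→ℚ b
ℤ→ℚ-* a b = sym (cong₂ _*_ (ℤ→ℚ-mkℚ a) (ℤ→ℚ-mkℚ b))

ℤ→ℚ-mono-≤ : ∀ {a b} → a ℤ.≤ b → ℤ→ℚ a ≤ ℤ→ℚ b
ℤ→ℚ-mono-≤ {a} {b} a≤b rewrite ℤ→ℚ-mkℚ a | ℤ→ℚ-mkℚ b = *≤* (ℤₚ.*-monoʳ-≤-nonNeg (+ 1) a≤b)

ℤ→ℚ-cancel-≤ : ∀ {a b} → ℤ→ℚ a ≤ ℤ→ℚ b → a ℤ.≤ b
ℤ→ℚ-cancel-≤ {a} {b} a≤b rewrite ℤ→ℚ-mkℚ a | ℤ→ℚ-mkℚ b = ℤₚ.*-cancelʳ-≤-pos a b (+ 1) (ℚₚ.drop-*≤* a≤b)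

ℕ→ℚ-+ : ∀ a b → ℕ→ℚ (a ℕ.+ b) ≡ ℕ→ℚ a + ℕ→ℚ b
ℕ→ℚ-+ a b = ℤ→ℚ-+ (+ a) (+ b)

ℕ→ℚ-* : ∀ a b → ℕ→ℚ (a ℕ.* b) ≡ ℕ→ℚ a * ℕ→ℚ b
ℕ→ℚ-* a b = trans (cong ℤ→ℚ (ℤₚ.pos-* a b)) (ℤ→ℚ-* (+ a) (+ b))

ℕ→ℚ-suc : ∀ a → ℕ→ℚ (suc a) ≡ 1ℚ + ℕ→ℚ a
ℕ→ℚ-suc a = ℕ→ℚ-+ 1 a

ℕ→ℚ-nonneg : ∀ a → 0ℚ ≤ ℕ→ℚ a
ℕ→ℚ-nonneg a = ℤ→ℚ-mono-≤ {+ 0} {+ a} (ℤ.+≤+ ℕ.z≤n)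

-- Certificates of nonnegativity

infixl 6 _⊕_
infixl 7 _⊗_

_⊕_ : ∀ {a b} → 0ℚ ≤ a → 0ℚ ≤ b → 0ℚ ≤ a + b
_⊕_ = ℚₚ.+-mono-≤

_⊗_ : ∀ {a b} → 0ℚ ≤ a → 0ℚ ≤ b → 0ℚ ≤ a * b
_⊗_ {a} {b} 0≤a 0≤b = subst (_≤ a * b) (ℚₚ.*-zeroʳ a) (ℚₚ.*-monoˡ-≤-nonNeg a {{ℚ.nonNegative 0≤a}} 0≤b)

0≤1 : 0ℚ ≤ 1ℚ
0≤1 = ℕ→ℚ-nonneg 1

≤⇒0≤- : ∀ {a b} → a ≤ b → 0ℚ ≤ b - a
≤⇒0≤- {a} {b} a≤b = subst (_≤ b - a) (ℚₚ.+-inverseʳ a) (ℚₚ.+-monoˡ-≤ (- a) a≤b)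

0≤-⇒≤ : ∀ {a b} → 0ℚ ≤ b - a → a ≤ b
0≤-⇒≤ {a} {b} 0≤b-a = subst₂ _≤_ (ℚₚ.+-identityʳ a) (cancel a b) (ℚₚ.+-monoʳ-≤ a 0≤b-a)
  where
  cancel : ∀ a b → a + (b - a) ≡ b
  cancel = solve-∀ ℚ-ring

infixr 0 _by_
-- With `_⊕_` and `_⊗_` this is a format for certificates: a visibly nonnegative expression is
-- assembled first, and an identity then carries its sign over to the wanted one.
_by_ : ∀ {a b} → 0ℚ ≤ a → b ≡ a → 0ℚ ≤ b
0≤a by eq = subst (0ℚ ≤_) (sym eq) 0≤a

-- τ is (y - b) / (t - b) unless the interval is a single point. That case does arise below: for j =
-- 0 the vertical intervals shrink to points, and for δ = 0 the right strip has width zero.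
interpolate : ∀ {b y t} → 0ℚ ≤ y - b → 0ℚ ≤ t - y →
              Σ ℚ λ τ → 0ℚ ≤ τ × 0ℚ ≤ 1ℚ - τ × y ≡ (1ℚ - τ) * b + τ * t
interpolate {b} {y} {t} b≤y y≤t with t - b ℚₚ.≟ 0ℚ
... | yes t-b≡0 = 0ℚ , ℚₚ.≤-refl , 0≤1 , trans y≡b (sym (at-b b t))
  where
  at-b : ∀ b t → (1ℚ - 0ℚ) * b + 0ℚ * t ≡ b
  at-b = solve-∀ ℚ-ring
  to-b : ∀ b y t → b - y ≡ (t - y) - (t - b)
  to-b = solve-∀ ℚ-ring
  t-y : ∀ a → a - 0ℚ ≡ a
  t-y = solve-∀ ℚ-ring
  y≡b : y ≡ b
  y≡b = ℚₚ.≤-antisym (0≤-⇒≤ (y≤t by trans (to-b b y t) (trans (cong (λ s → (t - y) - s) t-b≡0) (t-y _)))) (0≤-⇒≤ b≤y)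
... | no t-b≢0 = τ , b≤y ⊗ 0≤r , (y≤t ⊗ 0≤r by 1-τ) , y-eq
  where
  0≤t-b : 0ℚ ≤ t - b
  0≤t-b = y≤t ⊕ b≤y by split b y t
    where
    split : ∀ b y t → t - b ≡ (t - y) + (y - b)
    split = solve-∀ ℚ-ring
  instance
    nonZero : ℚ.NonZero (t - b)
    nonZero = ℚ.≢-nonZero t-b≢0
    nonNeg : ℚ.NonNegative (t - b)
    nonNeg = ℚ.nonNegative 0≤t-b
    pos : ℚ.Positive (t - b)
    pos = ℚₚ.nonNeg∧nonZero⇒pos (t - b)
  r τ : ℚ
  r = ℚ.1/ (t - b)
  τ = (y - b) * r
  0≤r : 0ℚ ≤ r
  0≤r = ℚₚ.<⇒≤ (ℚₚ.positive⁻¹ r {{ℚₚ.1/pos⇒pos (t - b)}})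
  inv : (t - b) * r ≡ 1ℚ
  inv = ℚₚ.*-inverseʳ (t - b)
  1-τ : 1ℚ - τ ≡ (t - y) * r
  1-τ = trans (cong (λ s → s - τ) (sym inv)) (eq b y t r)
    where
    eq : ∀ b y t r → (t - b) * r - (y - b) * r ≡ (t - y) * r
    eq = solve-∀ ℚ-ring
  y-eq : y ≡ (1ℚ - τ) * b + τ * t
  y-eq = trans (trans (one b y) (cong (λ s → b + (y - b) * s) (sym inv))) (eq b y t r)
    where
    one : ∀ b y → y ≡ b + (y - b) * 1ℚ
    one = solve-∀ ℚ-ring
    eq : ∀ b y t r → b + (y - b) * ((t - b) * r) ≡ (1ℚ - (y - b) * r) * b + ((y - b) * r) * t
    eq = solve-∀ ℚ-ring

sumℚ-*0 : ∀ {m} (lam : Fin m → ℚ) → sumℚ (λ i → lam i * 0ℚ) ≡ 0ℚ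
sumℚ-*0 {zero} lam = refl
sumℚ-*0 {suc m} lam = cong₂ _+_ (ℚₚ.*-zeroʳ (lam zero)) (sumℚ-*0 (λ i → lam (suc i)))

sumℚ-cong : ∀ {m} {f g : Fin m → ℚ} → (∀ i → f i ≡ g i) → sumℚ f ≡ sumℚ g
sumℚ-cong {zero} f≗g = refl
sumℚ-cong {suc m} f≗g = cong₂ _+_ (f≗g zero) (sumℚ-cong (λ i → f≗g (suc i)))

*-sumℚ : ∀ {m} a (f : Fin m → ℚ) → a * sumℚ f ≡ sumℚ (λ i → a * f i)
*-sumℚ {zero} a f = ℚₚ.*-zeroʳ a
*-sumℚ {suc m} a f = trans (ℚₚ.*-distribˡ-+ a (f zero) _) (cong (λ s → a * f zero + s) (*-sumℚ a (λ i → f (suc i))))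

reciprocal : ∀ a → Σ ℚ λ r → 0ℚ ≤ r × ℕ→ℚ (suc a) * r ≡ 1ℚ
reciprocal a = ℚ.1/ ℕ→ℚ (suc a) , ℚₚ.<⇒≤ (ℚₚ.positive⁻¹ _ {{ℚₚ.1/pos⇒pos (ℕ→ℚ (suc a))}}) , ℚₚ.*-inverseʳ (ℕ→ℚ (suc a))
  where
  instance
    pos : ℚ.Positive (ℕ→ℚ (suc a))
    pos = ℚₚ.normalize-pos (suc a) 1
    nonZero : ℚ.NonZero (ℕ→ℚ (suc a))
    nonZero = ℚₚ.pos⇒nonZero (ℕ→ℚ (suc a))

-- The polytope as a convex hull and as a system of inequalities

-- Here 1 + π and 1 + δ are p₀ and p₁, and η and ε are their reciprocals.
module Geometry
  (π η δ ε : ℚ) (0≤π : 0ℚ ≤ π) (0≤η : 0ℚ ≤ η) (0≤δ : 0ℚ ≤ δ) (0≤ε : 0ℚ ≤ ε)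
  (η-inv : (1ℚ + π) * η ≡ 1ℚ) (ε-inv : (1ℚ + δ) * ε ≡ 1ℚ)
  where

  -- Bottom and top at the abscissas 0, 1, 2 and 2 + δ, so that consecutive pairs bound three
  -- vertical strips; the prism is 1 ≤ x ≤ 2. For δ = 0 the last two pairs coincide.
  baseVerts : Fin 8 → Pt 2
  baseVerts = (0ℚ        ∷ - η   ∷ []) ∷ (0ℚ        ∷ δ     ∷ [])
            ∷ (1ℚ        ∷ - 1ℚ  ∷ []) ∷ (1ℚ        ∷ δ + ε ∷ [])
            ∷ (1ℚ + 1ℚ   ∷ - 1ℚ  ∷ []) ∷ (1ℚ + 1ℚ   ∷ δ + ε ∷ [])
            ∷ (1ℚ + 1ℚ + δ ∷ - 1ℚ ∷ []) ∷ (1ℚ + 1ℚ + δ ∷ 1ℚ   ∷ [])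
            ∷ []

  xDir : ∀ m → Pt (suc (suc m))
  xDir zero    = 1ℚ ∷ 0ℚ ∷ []
  xDir (suc m) = 0ℚ ∷ xDir m

  #verts : ℕ → ℕ
  #verts zero    = 8
  #verts (suc m) = suc (suc (#verts m))

  -- At height 1 in the new coordinate stands a unit segment in the x-direction instead of an apex:
  -- the prolongation stretches the apex of the pyramid as much as its base.
  vertices : ∀ m → Fin (#verts m) → Pt (suc (suc m))
  vertices zero    = baseVerts
  vertices (suc m) = (1ℚ ∷ λ _ → 0ℚ) ∷ (1ℚ ∷ xDir m) ∷ λ i → 0ℚ ∷ vertices m i

  -- The slopes change at x = j and at x = 2j + e. The inequalities are cleared of the denominators
  -- p₀ and p₁; neither η nor ε occurs, and at integer points the bounds for y become floors.
  record BaseRegion (e j x y : ℚ) : Set where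
    field
      left     : 0ℚ ≤ x
      right    : 0ℚ ≤ e + (1ℚ + 1ℚ + δ) * j - x
      lower-left : 0ℚ ≤ (1ℚ + π) * (y + x) + j - x
      lower    : 0ℚ ≤ y + j
      upper-left  : 0ℚ ≤ (1ℚ + δ) * (δ * j - y) + x
      upper    : 0ℚ ≤ (1ℚ + δ) * (δ * j - y) + j
      upper-right : 0ℚ ≤ (1ℚ + δ) * (δ * j - y) + j - δ * (x - (j + j + e))

  -- Region m e j is the j-th dilate of the m-fold pyramid over Q plus a segment of length j + e in the
  -- x-direction.  Fixing the first coordinate at a shrinks the pyramid to j − a but keeps the segment.
  Region : ∀ m → ℚ → ℚ → Pt (suc (suc m)) → Set
  Region zero    e j z = BaseRegion e j (z zero) (z (suc zero))
  Region (suc m) e j z = 0ℚ ≤ z zero × 0ℚ ≤ j - z zero × Region m (e + z zero) (j - z zero) (tail z)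

  -- Weights of sum j absorb the dilation factor, so slices of all sizes, j = 0 included, have the
  -- same format. The `shift` accounts for the length e of the segment that the vertices, which
  -- already supply length j, do not cover.
  record Hull m (e j : ℚ) (z : Pt (suc (suc m))) : Set where
    field
      weight   : Fin (#verts m) → ℚ
      weight≥0 : ∀ i → 0ℚ ≤ weight i
      sum≡j    : sumℚ weight ≡ j
      shift    : ℚ
      shift≥0  : 0ℚ ≤ shift
      shift≤e  : 0ℚ ≤ e - shift
      point    : ∀ c → z c ≡ sumℚ (λ i → weight i * vertices m i c) + shift * xDir m c

  private
    -- A ring identity cannot appeal to `η-inv`. The certificates therefore carry a multiple of 1 -
    -- (1 + π)η explicitly, and it enters the sum as one more nonnegative term.
    η-defect : ∀ w → 0ℚ ≤ (1ℚ - (1ℚ + π) * η) * w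
    η-defect w = ℚₚ.≤-reflexive (sym (trans (cong (λ a → (1ℚ - a) * w) η-inv) (ℚₚ.*-zeroˡ w)))

    ε-defect : ∀ w → 0ℚ ≤ (1ℚ - (1ℚ + δ) * ε) * w
    ε-defect w = ℚₚ.≤-reflexive (sym (trans (cong (λ a → (1ℚ - a) * w) ε-inv) (ℚₚ.*-zeroˡ w)))

    0≤1-η : 0ℚ ≤ 1ℚ - η
    0≤1-η = 0≤π ⊗ 0≤η ⊕ η-defect 1ℚ by eq π η
      where
      eq : ∀ π η → 1ℚ - η ≡ π * η + (1ℚ - (1ℚ + π) * η) * 1ℚ
      eq = solve-∀ ℚ-ring

    0≤D = 0≤1 ⊕ 0≤δ
    0≤P = 0≤1 ⊕ 0≤π
    0≤δ+ε = 0≤δ ⊕ 0≤ε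

  -- Every affine form below is the combination of its (nonnegative) vertex values with the given weights.
  hull⇒baseRegion : ∀ {e j z} → Hull 0 e j z → BaseRegion e j (z zero) (z (suc zero))
  hull⇒baseRegion {e} H rewrite H .Hull.point zero | H .Hull.point (suc zero) | sym (H .Hull.sum≡j) = record
    { left = 0≤1 ⊗ w≥0 v₂ ⊕ 0≤1 ⊗ w≥0 v₃ ⊕ 0≤1 ⊗ w≥0 v₄ ⊕ 0≤1 ⊗ w≥0 v₄ ⊕ 0≤1 ⊗ w≥0 v₅ ⊕ 0≤1 ⊗ w≥0 v₅ ⊕ 0≤D ⊗ w≥0 v₆
      ⊕ 0≤1 ⊗ w≥0 v₆ ⊕ 0≤D ⊗ w≥0 v₇ ⊕ 0≤1 ⊗ w≥0 v₇ ⊕ shift≥0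
        by left-cert π η δ ε e shift (w v₀) (w v₁) (w v₂) (w v₃) (w v₄) (w v₅) (w v₆) (w v₇)
    ; right = 0≤D ⊗ w≥0 v₀ ⊕ 0≤1 ⊗ w≥0 v₀ ⊕ 0≤D ⊗ w≥0 v₁ ⊕ 0≤1 ⊗ w≥0 v₁ ⊕ 0≤D ⊗ w≥0 v₂ ⊕ 0≤D ⊗ w≥0 v₃ ⊕ 0≤δ ⊗ w≥0 v₄
      ⊕ 0≤δ ⊗ w≥0 v₅ ⊕ shift≤e
        by right-cert π η δ ε e shift (w v₀) (w v₁) (w v₂) (w v₃) (w v₄) (w v₅) (w v₆) (w v₇)
    ; lower-left = η-defect (w v₀) ⊕ 0≤P ⊗ 0≤δ ⊗ w≥0 v₁ ⊕ 0≤1 ⊗ w≥0 v₁ ⊕ 0≤P ⊗ 0≤δ+ε ⊗ w≥0 v₃ ⊕ 0≤P ⊗ w≥0 v₃ ⊕ 0≤π ⊗ w≥0 v₄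
      ⊕ 0≤P ⊗ 0≤δ+ε ⊗ w≥0 v₅ ⊕ 0≤P ⊗ w≥0 v₅ ⊕ 0≤π ⊗ w≥0 v₅ ⊕ 0≤π ⊗ 0≤D ⊗ w≥0 v₆ ⊕ 0≤π ⊗ 0≤D ⊗ w≥0 v₇ ⊕ 0≤P ⊗ w≥0 v₇
      ⊕ 0≤P ⊗ w≥0 v₇ ⊕ 0≤π ⊗ shift≥0
        by lower-left-cert π η δ ε e shift (w v₀) (w v₁) (w v₂) (w v₃) (w v₄) (w v₅) (w v₆) (w v₇)
    ; lower = 0≤1-η ⊗ w≥0 v₀ ⊕ 0≤D ⊗ w≥0 v₁ ⊕ 0≤δ+ε ⊗ w≥0 v₃ ⊕ 0≤1 ⊗ w≥0 v₃ ⊕ 0≤δ+ε ⊗ w≥0 v₅ ⊕ 0≤1 ⊗ w≥0 v₅ ⊕ 0≤1 ⊗ w≥0 v₇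
      ⊕ 0≤1 ⊗ w≥0 v₇
        by lower-cert π η δ ε e shift (w v₀) (w v₁) (w v₂) (w v₃) (w v₄) (w v₅) (w v₆) (w v₇)
    ; upper-left = 0≤D ⊗ 0≤δ ⊗ w≥0 v₀ ⊕ 0≤D ⊗ 0≤η ⊗ w≥0 v₀ ⊕ 0≤D ⊗ 0≤δ ⊗ w≥0 v₂ ⊕ 0≤1 ⊗ w≥0 v₂ ⊕ 0≤D ⊗ w≥0 v₂ ⊕ ε-defect (w v₃)
      ⊕ 0≤D ⊗ 0≤δ ⊗ w≥0 v₄ ⊕ 0≤1 ⊗ w≥0 v₄ ⊕ 0≤1 ⊗ w≥0 v₄ ⊕ 0≤D ⊗ w≥0 v₄ ⊕ 0≤1 ⊗ w≥0 v₅ ⊕ ε-defect (w v₅) ⊕ 0≤D ⊗ 0≤δ ⊗ w≥0 v₆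
      ⊕ 0≤D ⊗ w≥0 v₆ ⊕ 0≤1 ⊗ w≥0 v₆ ⊕ 0≤D ⊗ w≥0 v₆ ⊕ 0≤D ⊗ 0≤δ ⊗ w≥0 v₇ ⊕ 0≤1 ⊗ w≥0 v₇ ⊕ shift≥0
        by upper-left-cert π η δ ε e shift (w v₀) (w v₁) (w v₂) (w v₃) (w v₄) (w v₅) (w v₆) (w v₇)
    ; upper = 0≤D ⊗ 0≤δ ⊗ w≥0 v₀ ⊕ 0≤1 ⊗ w≥0 v₀ ⊕ 0≤D ⊗ 0≤η ⊗ w≥0 v₀ ⊕ 0≤1 ⊗ w≥0 v₁ ⊕ 0≤D ⊗ 0≤δ ⊗ w≥0 v₂ ⊕ 0≤1 ⊗ w≥0 v₂
      ⊕ 0≤D ⊗ w≥0 v₂ ⊕ ε-defect (w v₃) ⊕ 0≤D ⊗ 0≤δ ⊗ w≥0 v₄ ⊕ 0≤1 ⊗ w≥0 v₄ ⊕ 0≤D ⊗ w≥0 v₄ ⊕ ε-defect (w v₅) ⊕ 0≤D ⊗ 0≤δ ⊗ w≥0 v₆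
      ⊕ 0≤1 ⊗ w≥0 v₆ ⊕ 0≤D ⊗ w≥0 v₆ ⊕ 0≤δ ⊗ 0≤δ ⊗ w≥0 v₇
        by upper-cert π η δ ε e shift (w v₀) (w v₁) (w v₂) (w v₃) (w v₄) (w v₅) (w v₆) (w v₇)
    ; upper-right = 0≤D ⊗ 0≤δ ⊗ w≥0 v₀ ⊕ 0≤1 ⊗ w≥0 v₀ ⊕ 0≤δ ⊗ w≥0 v₀ ⊕ 0≤δ ⊗ w≥0 v₀ ⊕ 0≤D ⊗ 0≤η ⊗ w≥0 v₀ ⊕ 0≤1 ⊗ w≥0 v₁
      ⊕ 0≤δ ⊗ w≥0 v₁ ⊕ 0≤δ ⊗ w≥0 v₁ ⊕ 0≤D ⊗ 0≤δ ⊗ w≥0 v₂ ⊕ 0≤1 ⊗ w≥0 v₂ ⊕ 0≤δ ⊗ w≥0 v₂ ⊕ 0≤D ⊗ w≥0 v₂ ⊕ 0≤δ ⊗ w≥0 v₃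
      ⊕ ε-defect (w v₃) ⊕ 0≤D ⊗ 0≤δ ⊗ w≥0 v₄ ⊕ 0≤1 ⊗ w≥0 v₄ ⊕ 0≤D ⊗ w≥0 v₄ ⊕ ε-defect (w v₅) ⊕ 0≤D ⊗ w≥0 v₆ ⊕ 0≤D ⊗ w≥0 v₆
      ⊕ 0≤δ ⊗ shift≤e
        by upper-right-cert π η δ ε e shift (w v₀) (w v₁) (w v₂) (w v₃) (w v₄) (w v₅) (w v₆) (w v₇)
    }
    where
    open Hull H renaming (weight to w; weight≥0 to w≥0)
    pattern v₀ = zero
    pattern v₁ = suc v₀
    pattern v₂ = suc v₁
    pattern v₃ = suc v₂
    pattern v₄ = suc v₃
    pattern v₅ = suc v₄
    pattern v₆ = suc v₅
    pattern v₇ = suc v₆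
    -- In each certificate x, y and j are spelled out as the sums over the eight vertices to which
    -- `sumℚ` unfolds, so that the solver sees variables only.
    left-cert : ∀ π η δ ε e d l₀ l₁ l₂ l₃ l₄ l₅ l₆ l₇ →
      let x = l₀ * 0ℚ + (l₁ * 0ℚ + (l₂ * 1ℚ + (l₃ * 1ℚ
              + (l₄ * (1ℚ + 1ℚ) + (l₅ * (1ℚ + 1ℚ) + (l₆ * (1ℚ + 1ℚ + δ) + (l₇ * (1ℚ + 1ℚ + δ) + 0ℚ))))))) + d * 1ℚ
          y = l₀ * (- η)
            + (l₁ * δ + (l₂ * (- 1ℚ) + (l₃ * (δ + ε) + (l₄ * (- 1ℚ) + (l₅ * (δ + ε) + (l₆ * (- 1ℚ) + (l₇ * 1ℚ + 0ℚ))))))) + d * 0ℚ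
          j = l₀ + (l₁ + (l₂ + (l₃ + (l₄ + (l₅ + (l₆ + (l₇ + 0ℚ)))))))
      in x ≡
         1ℚ * l₂ + 1ℚ * l₃ + 1ℚ * l₄ + 1ℚ * l₄ + 1ℚ * l₅ + 1ℚ * l₅ + (1ℚ + δ) * l₆ + 1ℚ * l₆ + (1ℚ + δ) * l₇ + 1ℚ * l₇ + d
    left-cert = solve-∀ ℚ-ring
    right-cert : ∀ π η δ ε e d l₀ l₁ l₂ l₃ l₄ l₅ l₆ l₇ →
      let x = l₀ * 0ℚ + (l₁ * 0ℚ + (l₂ * 1ℚ + (l₃ * 1ℚ
              + (l₄ * (1ℚ + 1ℚ) + (l₅ * (1ℚ + 1ℚ) + (l₆ * (1ℚ + 1ℚ + δ) + (l₇ * (1ℚ + 1ℚ + δ) + 0ℚ))))))) + d * 1ℚ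
          y = l₀ * (- η)
            + (l₁ * δ + (l₂ * (- 1ℚ) + (l₃ * (δ + ε) + (l₄ * (- 1ℚ) + (l₅ * (δ + ε) + (l₆ * (- 1ℚ) + (l₇ * 1ℚ + 0ℚ))))))) + d * 0ℚ
          j = l₀ + (l₁ + (l₂ + (l₃ + (l₄ + (l₅ + (l₆ + (l₇ + 0ℚ)))))))
      in e + (1ℚ + 1ℚ + δ) * j - x ≡
         (1ℚ + δ) * l₀ + 1ℚ * l₀ + (1ℚ + δ) * l₁ + 1ℚ * l₁ + (1ℚ + δ) * l₂ + (1ℚ + δ) * l₃ + δ * l₄ + δ * l₅ + (e - d)
    right-cert = solve-∀ ℚ-ring
    lower-left-cert : ∀ π η δ ε e d l₀ l₁ l₂ l₃ l₄ l₅ l₆ l₇ →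
      let x = l₀ * 0ℚ + (l₁ * 0ℚ + (l₂ * 1ℚ + (l₃ * 1ℚ
              + (l₄ * (1ℚ + 1ℚ) + (l₅ * (1ℚ + 1ℚ) + (l₆ * (1ℚ + 1ℚ + δ) + (l₇ * (1ℚ + 1ℚ + δ) + 0ℚ))))))) + d * 1ℚ
          y = l₀ * (- η)
            + (l₁ * δ + (l₂ * (- 1ℚ) + (l₃ * (δ + ε) + (l₄ * (- 1ℚ) + (l₅ * (δ + ε) + (l₆ * (- 1ℚ) + (l₇ * 1ℚ + 0ℚ))))))) + d * 0ℚ
          j = l₀ + (l₁ + (l₂ + (l₃ + (l₄ + (l₅ + (l₆ + (l₇ + 0ℚ)))))))
      in (1ℚ + π) * (y + x) + j - x ≡
         (1ℚ - (1ℚ + π) * η) * l₀ + (1ℚ + π) * δ * l₁ + 1ℚ * l₁ + (1ℚ + π) * (δ + ε) * l₃ + (1ℚ + π) * l₃ + π * l₄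
           + (1ℚ + π) * (δ + ε) * l₅ + (1ℚ + π) * l₅ + π * l₅ + π * (1ℚ + δ) * l₆ + π * (1ℚ + δ) * l₇ + (1ℚ + π) * l₇
           + (1ℚ + π) * l₇ + π * d
    lower-left-cert = solve-∀ ℚ-ring
    lower-cert : ∀ π η δ ε e d l₀ l₁ l₂ l₃ l₄ l₅ l₆ l₇ →
      let x = l₀ * 0ℚ + (l₁ * 0ℚ + (l₂ * 1ℚ + (l₃ * 1ℚ
              + (l₄ * (1ℚ + 1ℚ) + (l₅ * (1ℚ + 1ℚ) + (l₆ * (1ℚ + 1ℚ + δ) + (l₇ * (1ℚ + 1ℚ + δ) + 0ℚ))))))) + d * 1ℚ
          y = l₀ * (- η)
            + (l₁ * δ + (l₂ * (- 1ℚ) + (l₃ * (δ + ε) + (l₄ * (- 1ℚ) + (l₅ * (δ + ε) + (l₆ * (- 1ℚ) + (l₇ * 1ℚ + 0ℚ))))))) + d * 0ℚ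
          j = l₀ + (l₁ + (l₂ + (l₃ + (l₄ + (l₅ + (l₆ + (l₇ + 0ℚ)))))))
      in y + j ≡
         (1ℚ - η) * l₀ + (1ℚ + δ) * l₁ + (δ + ε) * l₃ + 1ℚ * l₃ + (δ + ε) * l₅ + 1ℚ * l₅ + 1ℚ * l₇ + 1ℚ * l₇
    lower-cert = solve-∀ ℚ-ring
    upper-left-cert : ∀ π η δ ε e d l₀ l₁ l₂ l₃ l₄ l₅ l₆ l₇ →
      let x = l₀ * 0ℚ + (l₁ * 0ℚ + (l₂ * 1ℚ + (l₃ * 1ℚ
              + (l₄ * (1ℚ + 1ℚ) + (l₅ * (1ℚ + 1ℚ) + (l₆ * (1ℚ + 1ℚ + δ) + (l₇ * (1ℚ + 1ℚ + δ) + 0ℚ))))))) + d * 1ℚ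
          y = l₀ * (- η)
            + (l₁ * δ + (l₂ * (- 1ℚ) + (l₃ * (δ + ε) + (l₄ * (- 1ℚ) + (l₅ * (δ + ε) + (l₆ * (- 1ℚ) + (l₇ * 1ℚ + 0ℚ))))))) + d * 0ℚ
          j = l₀ + (l₁ + (l₂ + (l₃ + (l₄ + (l₅ + (l₆ + (l₇ + 0ℚ)))))))
      in (1ℚ + δ) * (δ * j - y) + x ≡
         (1ℚ + δ) * δ * l₀ + (1ℚ + δ) * η * l₀ + (1ℚ + δ) * δ * l₂ + 1ℚ * l₂ + (1ℚ + δ) * l₂ + (1ℚ - (1ℚ + δ) * ε) * l₃
           + (1ℚ + δ) * δ * l₄ + 1ℚ * l₄ + 1ℚ * l₄ + (1ℚ + δ) * l₄ + 1ℚ * l₅ + (1ℚ - (1ℚ + δ) * ε) * l₅ + (1ℚ + δ) * δ * l₆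
           + (1ℚ + δ) * l₆ + 1ℚ * l₆ + (1ℚ + δ) * l₆ + (1ℚ + δ) * δ * l₇ + 1ℚ * l₇ + d
    upper-left-cert = solve-∀ ℚ-ring
    upper-cert : ∀ π η δ ε e d l₀ l₁ l₂ l₃ l₄ l₅ l₆ l₇ →
      let x = l₀ * 0ℚ + (l₁ * 0ℚ + (l₂ * 1ℚ + (l₃ * 1ℚ
              + (l₄ * (1ℚ + 1ℚ) + (l₅ * (1ℚ + 1ℚ) + (l₆ * (1ℚ + 1ℚ + δ) + (l₇ * (1ℚ + 1ℚ + δ) + 0ℚ))))))) + d * 1ℚ
          y = l₀ * (- η)
            + (l₁ * δ + (l₂ * (- 1ℚ) + (l₃ * (δ + ε) + (l₄ * (- 1ℚ) + (l₅ * (δ + ε) + (l₆ * (- 1ℚ) + (l₇ * 1ℚ + 0ℚ))))))) + d * 0ℚ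
          j = l₀ + (l₁ + (l₂ + (l₃ + (l₄ + (l₅ + (l₆ + (l₇ + 0ℚ)))))))
      in (1ℚ + δ) * (δ * j - y) + j ≡
         (1ℚ + δ) * δ * l₀ + 1ℚ * l₀ + (1ℚ + δ) * η * l₀ + 1ℚ * l₁ + (1ℚ + δ) * δ * l₂ + 1ℚ * l₂ + (1ℚ + δ) * l₂
           + (1ℚ - (1ℚ + δ) * ε) * l₃ + (1ℚ + δ) * δ * l₄ + 1ℚ * l₄ + (1ℚ + δ) * l₄ + (1ℚ - (1ℚ + δ) * ε) * l₅
           + (1ℚ + δ) * δ * l₆ + 1ℚ * l₆ + (1ℚ + δ) * l₆ + δ * δ * l₇
    upper-cert = solve-∀ ℚ-ring
    upper-right-cert : ∀ π η δ ε e d l₀ l₁ l₂ l₃ l₄ l₅ l₆ l₇ →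
      let x = l₀ * 0ℚ + (l₁ * 0ℚ + (l₂ * 1ℚ + (l₃ * 1ℚ
              + (l₄ * (1ℚ + 1ℚ) + (l₅ * (1ℚ + 1ℚ) + (l₆ * (1ℚ + 1ℚ + δ) + (l₇ * (1ℚ + 1ℚ + δ) + 0ℚ))))))) + d * 1ℚ
          y = l₀ * (- η)
            + (l₁ * δ + (l₂ * (- 1ℚ) + (l₃ * (δ + ε) + (l₄ * (- 1ℚ) + (l₅ * (δ + ε) + (l₆ * (- 1ℚ) + (l₇ * 1ℚ + 0ℚ))))))) + d * 0ℚ
          j = l₀ + (l₁ + (l₂ + (l₃ + (l₄ + (l₅ + (l₆ + (l₇ + 0ℚ)))))))
      in (1ℚ + δ) * (δ * j - y) + j - δ * (x - (j + j + e)) ≡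
         (1ℚ + δ) * δ * l₀ + 1ℚ * l₀ + δ * l₀ + δ * l₀ + (1ℚ + δ) * η * l₀ + 1ℚ * l₁ + δ * l₁ + δ * l₁ + (1ℚ + δ) * δ * l₂
           + 1ℚ * l₂ + δ * l₂ + (1ℚ + δ) * l₂ + δ * l₃ + (1ℚ - (1ℚ + δ) * ε) * l₃ + (1ℚ + δ) * δ * l₄ + 1ℚ * l₄ + (1ℚ + δ) * l₄
           + (1ℚ - (1ℚ + δ) * ε) * l₅ + (1ℚ + δ) * l₆ + (1ℚ + δ) * l₆ + δ * (e - d)
    upper-right-cert = solve-∀ ℚ-ring

  -- At height a the two vertices over height 1 have total weight a. The weight of the second one is
  -- at the same time a displacement in the x-direction and joins the shift, which is why the slice
  -- is allowed e + a.
  hull⇒region : ∀ m {e j z} → Hull m e j z → Region m e j z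
  hull⇒region zero H = hull⇒baseRegion H
  hull⇒region (suc m) {e} {j} {z} H =
      (w≥0 zero ⊕ w≥0 (suc zero) by z₀)
    , (0≤sum (λ i → w≥0 (suc (suc i))) by trans (cong₂ _-_ (sym sum≡j) z₀) (rest (w zero) (w (suc zero)) _))
    , hull⇒region m record
        { weight = λ i → w (suc (suc i))
        ; weight≥0 = λ i → w≥0 (suc (suc i))
        ; sum≡j = sym (trans (cong₂ _-_ (sym sum≡j) z₀) (rest (w zero) (w (suc zero)) _))
        ; shift = w (suc zero) + shift
        ; shift≥0 = w≥0 (suc zero) ⊕ shift≥0
        ; shift≤e = w≥0 zero ⊕ shift≤e by trans (cong (λ a → e + a - (w (suc zero) + shift)) z₀) (slack e (w zero) (w (suc zero)) shift)
        ; point = λ c → trans (point (suc c)) (move (w zero) (w (suc zero)) shift (xDir m c) _)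
        }
    where
    open Hull H renaming (weight to w; weight≥0 to w≥0)
    0≤sum : ∀ {n} {f : Fin n → ℚ} → (∀ i → 0ℚ ≤ f i) → 0ℚ ≤ sumℚ f
    0≤sum {zero} f≥0 = ℚₚ.≤-refl
    0≤sum {suc n} f≥0 = f≥0 zero ⊕ 0≤sum (λ i → f≥0 (suc i))
    head : ∀ a b d → a * 1ℚ + (b * 1ℚ + 0ℚ) + d * 0ℚ ≡ a + b
    head = solve-∀ ℚ-ring
    z₀ : z zero ≡ w zero + w (suc zero)
    z₀ = trans (point zero)
        (trans (cong (λ s → w zero * 1ℚ + (w (suc zero) * 1ℚ + s) + shift * 0ℚ)
                     (sumℚ-*0 (λ i → w (suc (suc i)))))
               (head (w zero) (w (suc zero)) shift))
    rest : ∀ a b s → a + (b + s) - (a + b) ≡ s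
    rest = solve-∀ ℚ-ring
    slack : ∀ e a b d → e + (a + b) - (b + d) ≡ a + (e - d)
    slack = solve-∀ ℚ-ring
    move : ∀ a b d v s → a * 0ℚ + (b * v + s) + d * v ≡ s + (b + d) * v
    move = solve-∀ ℚ-ring

  -- Each strip is a trapezoid with vertical sides. Interpolation by σ across the strip and by τ
  -- along the column expresses the point through the four corners, with j times a product of σ or 1
  -- - σ and τ or 1 - τ as weights.
  baseRegion⇒hull : ∀ {e j} {z : Pt 2} → 0ℚ ≤ e → 0ℚ ≤ j → BaseRegion e j (z zero) (z (suc zero)) → Hull 0 e j z
  baseRegion⇒hull {e} {j} {z} 0≤e 0≤j R with ℚₚ.≤-total (z zero) j | ℚₚ.≤-total (z zero) (j + j + e)
  ... | inj₁ x≤j | _ = leftStrip (interpolate {0ℚ} {x} {j} (R .left by x-0 x) (≤⇒0≤- x≤j))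
    where
    open BaseRegion
    x = z zero
    y = z (suc zero)
    x-0 : ∀ x → x - 0ℚ ≡ x
    x-0 = solve-∀ ℚ-ring
    leftStrip : (Σ ℚ λ σ → 0ℚ ≤ σ × 0ℚ ≤ 1ℚ - σ × x ≡ (1ℚ - σ) * 0ℚ + σ * j) → Hull 0 e j z
    leftStrip (σ , 0≤σ , σ≤1 , x≡) = assemble (interpolate {b} {y} {t} b≤y y≤t)
      where
      b = (1ℚ - σ) * j * - η + σ * j * - 1ℚ
      t = (1ℚ - σ) * j * δ + σ * j * (δ + ε)
      b≤y : 0ℚ ≤ y - b
      b≤y = 0≤η ⊗ R .lower-left ⊕ η-defect (y + σ * j)
        by trans (eq π η j y σ) (cong (λ x → η * ((1ℚ + π) * (y + x) + j - x) + (1ℚ - (1ℚ + π) * η) * (y + σ * j)) (sym x≡))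
        where
        eq : ∀ π η j y σ → y - ((1ℚ - σ) * j * - η + σ * j * - 1ℚ) ≡
          η * ((1ℚ + π) * (y + ((1ℚ - σ) * 0ℚ + σ * j)) + j - ((1ℚ - σ) * 0ℚ + σ * j)) + (1ℚ - (1ℚ + π) * η) * (y + σ * j)
        eq = solve-∀ ℚ-ring
      y≤t : 0ℚ ≤ t - y
      y≤t = 0≤ε ⊗ R .upper-left ⊕ ε-defect (δ * j - y)
        by trans (eq δ ε j y σ) (cong (λ x → ε * ((1ℚ + δ) * (δ * j - y) + x) + (1ℚ - (1ℚ + δ) * ε) * (δ * j - y)) (sym x≡))
        where
        eq : ∀ δ ε j y σ → (1ℚ - σ) * j * δ + σ * j * (δ + ε) - y ≡
          ε * ((1ℚ + δ) * (δ * j - y) + ((1ℚ - σ) * 0ℚ + σ * j)) + (1ℚ - (1ℚ + δ) * ε) * (δ * j - y)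
        eq = solve-∀ ℚ-ring
      assemble : (Σ ℚ λ τ → 0ℚ ≤ τ × 0ℚ ≤ 1ℚ - τ × y ≡ (1ℚ - τ) * b + τ * t) → Hull 0 e j z
      assemble (τ , 0≤τ , τ≤1 , y≡) = record
        { weight = (1ℚ - σ) * j * (1ℚ - τ) ∷ (1ℚ - σ) * j * τ ∷ σ * j * (1ℚ - τ) ∷ σ * j * τ ∷ λ _ → 0ℚ
        ; weight≥0 = λ { zero → σ≤1 ⊗ 0≤j ⊗ τ≤1 ; (suc zero) → σ≤1 ⊗ 0≤j ⊗ 0≤τ
                       ; (suc (suc zero)) → 0≤σ ⊗ 0≤j ⊗ τ≤1 ; (suc (suc (suc zero))) → 0≤σ ⊗ 0≤j ⊗ 0≤τ
                       ; (suc (suc (suc (suc _)))) → ℚₚ.≤-refl }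
        ; sum≡j = total j σ τ
        ; shift = 0ℚ
        ; shift≥0 = ℚₚ.≤-refl
        ; shift≤e = 0≤e by x-0 e
        ; point = λ { zero → trans x≡ (x-eq δ j σ τ) ; (suc zero) → trans y≡ (y-eq η δ ε j σ τ) }
        }
        where
        total : ∀ j σ τ → (1ℚ - σ) * j * (1ℚ - τ) + ((1ℚ - σ) * j * τ + (σ * j * (1ℚ - τ) + (σ * j * τ
          + (0ℚ + (0ℚ + (0ℚ + (0ℚ + 0ℚ))))))) ≡ j
        total = solve-∀ ℚ-ring
        x-eq : ∀ δ j σ τ → (1ℚ - σ) * 0ℚ + σ * j ≡ (1ℚ - σ) * j * (1ℚ - τ) * 0ℚ + ((1ℚ - σ) * j * τ * 0ℚ + (σ * j * (1ℚ - τ) * 1ℚ + (σ * j * τ * 1ℚ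
          + (0ℚ * (1ℚ + 1ℚ) + (0ℚ * (1ℚ + 1ℚ) + (0ℚ * (1ℚ + 1ℚ + δ) + (0ℚ * (1ℚ + 1ℚ + δ) + 0ℚ))))))) + 0ℚ * 1ℚ
        x-eq = solve-∀ ℚ-ring
        y-eq : ∀ η δ ε j σ τ → (1ℚ - τ) * ((1ℚ - σ) * j * - η + σ * j * - 1ℚ) + τ * ((1ℚ - σ) * j * δ + σ * j * (δ + ε)) ≡
          (1ℚ - σ) * j * (1ℚ - τ) * - η + ((1ℚ - σ) * j * τ * δ + (σ * j * (1ℚ - τ) * - 1ℚ + (σ * j * τ * (δ + ε)
          + (0ℚ * - 1ℚ + (0ℚ * (δ + ε) + (0ℚ * - 1ℚ + (0ℚ * 1ℚ + 0ℚ))))))) + 0ℚ * 0ℚ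
        y-eq = solve-∀ ℚ-ring
  ... | inj₂ j≤x | inj₁ x≤2j+e = midStrip (interpolate {j} {x} {j + j + e} (≤⇒0≤- j≤x) (≤⇒0≤- x≤2j+e))
    where
    open BaseRegion
    x = z zero
    y = z (suc zero)
    midStrip : (Σ ℚ λ σ → 0ℚ ≤ σ × 0ℚ ≤ 1ℚ - σ × x ≡ (1ℚ - σ) * j + σ * (j + j + e)) → Hull 0 e j z
    midStrip (σ , 0≤σ , σ≤1 , x≡) = assemble (interpolate { - j } {y} {j * (δ + ε)} (R .lower by b≤y y j) y≤t)
      where
      b≤y : ∀ y j → y - (- j) ≡ y + j
      b≤y = solve-∀ ℚ-ring
      y≤t : 0ℚ ≤ j * (δ + ε) - y
      y≤t = 0≤ε ⊗ R .upper ⊕ ε-defect (δ * j - y) by eq δ ε j y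
        where
        eq : ∀ δ ε j y → j * (δ + ε) - y ≡ ε * ((1ℚ + δ) * (δ * j - y) + j) + (1ℚ - (1ℚ + δ) * ε) * (δ * j - y)
        eq = solve-∀ ℚ-ring
      assemble : (Σ ℚ λ τ → 0ℚ ≤ τ × 0ℚ ≤ 1ℚ - τ × y ≡ (1ℚ - τ) * - j + τ * (j * (δ + ε))) → Hull 0 e j z
      assemble (τ , 0≤τ , τ≤1 , y≡) = record
        { weight = 0ℚ ∷ 0ℚ ∷ (1ℚ - σ) * j * (1ℚ - τ) ∷ (1ℚ - σ) * j * τ ∷ σ * j * (1ℚ - τ) ∷ σ * j * τ ∷ λ _ → 0ℚ
        ; weight≥0 = λ { zero → ℚₚ.≤-refl ; (suc zero) → ℚₚ.≤-refl
                       ; (suc (suc zero)) → σ≤1 ⊗ 0≤j ⊗ τ≤1 ; (suc (suc (suc zero))) → σ≤1 ⊗ 0≤j ⊗ 0≤τ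
                       ; (suc (suc (suc (suc zero)))) → 0≤σ ⊗ 0≤j ⊗ τ≤1 ; (suc (suc (suc (suc (suc zero))))) → 0≤σ ⊗ 0≤j ⊗ 0≤τ
                       ; (suc (suc (suc (suc (suc (suc _)))))) → ℚₚ.≤-refl }
        ; sum≡j = total j σ τ
        -- The corners account for a width of j only, while the strip has width j + e; the shift
        -- grows with σ to cover the rest, from none in the left strip to all of e in the right one.
        ; shift = σ * e
        ; shift≥0 = 0≤σ ⊗ 0≤e
        ; shift≤e = σ≤1 ⊗ 0≤e by rest σ e
        ; point = λ { zero → trans x≡ (x-eq δ e j σ τ) ; (suc zero) → trans y≡ (y-eq η δ ε e j σ τ) }
        }
        where
        rest : ∀ σ e → e - σ * e ≡ (1ℚ - σ) * e
        rest = solve-∀ ℚ-ring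
        total : ∀ j σ τ → 0ℚ + (0ℚ + ((1ℚ - σ) * j * (1ℚ - τ) + ((1ℚ - σ) * j * τ + (σ * j * (1ℚ - τ) + (σ * j * τ
          + (0ℚ + (0ℚ + 0ℚ))))))) ≡ j
        total = solve-∀ ℚ-ring
        x-eq : ∀ δ e j σ τ → (1ℚ - σ) * j + σ * (j + j + e) ≡ 0ℚ * 0ℚ + (0ℚ * 0ℚ + ((1ℚ - σ) * j * (1ℚ - τ) * 1ℚ + ((1ℚ - σ) * j * τ * 1ℚ
          + (σ * j * (1ℚ - τ) * (1ℚ + 1ℚ) + (σ * j * τ * (1ℚ + 1ℚ) + (0ℚ * (1ℚ + 1ℚ + δ) + (0ℚ * (1ℚ + 1ℚ + δ) + 0ℚ))))))) + σ * e * 1ℚ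
        x-eq = solve-∀ ℚ-ring
        y-eq : ∀ η δ ε e j σ τ → (1ℚ - τ) * - j + τ * (j * (δ + ε)) ≡
          0ℚ * - η + (0ℚ * δ + ((1ℚ - σ) * j * (1ℚ - τ) * - 1ℚ + ((1ℚ - σ) * j * τ * (δ + ε)
          + (σ * j * (1ℚ - τ) * - 1ℚ + (σ * j * τ * (δ + ε) + (0ℚ * - 1ℚ + (0ℚ * 1ℚ + 0ℚ))))))) + σ * e * 0ℚ
        y-eq = solve-∀ ℚ-ring
  ... | inj₂ j≤x | inj₂ 2j+e≤x = rightStrip (interpolate {j + j + e} {x} {e + (1ℚ + 1ℚ + δ) * j} (≤⇒0≤- 2j+e≤x) (R .right))
    where
    open BaseRegion
    x = z zero
    y = z (suc zero)
    rightStrip : (Σ ℚ λ σ → 0ℚ ≤ σ × 0ℚ ≤ 1ℚ - σ × x ≡ (1ℚ - σ) * (j + j + e) + σ * (e + (1ℚ + 1ℚ + δ) * j)) → Hull 0 e j z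
    rightStrip (σ , 0≤σ , σ≤1 , x≡) = assemble (interpolate { - j } {y} {t} (R .lower by b≤y y j) y≤t)
      where
      t = (1ℚ - σ) * j * (δ + ε) + σ * j
      b≤y : ∀ y j → y - (- j) ≡ y + j
      b≤y = solve-∀ ℚ-ring
      y≤t : 0ℚ ≤ t - y
      y≤t = 0≤ε ⊗ R .upper-right ⊕ ε-defect (δ * j - y - (δ - 1ℚ) * σ * j)
        by trans (eq δ ε e j y σ) (cong (λ x → ε * ((1ℚ + δ) * (δ * j - y) + j - δ * (x - (j + j + e)))
             + (1ℚ - (1ℚ + δ) * ε) * (δ * j - y - (δ - 1ℚ) * σ * j)) (sym x≡))
        where
        eq : ∀ δ ε e j y σ → (1ℚ - σ) * j * (δ + ε) + σ * j - y ≡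
          ε * ((1ℚ + δ) * (δ * j - y) + j - δ * ((1ℚ - σ) * (j + j + e) + σ * (e + (1ℚ + 1ℚ + δ) * j) - (j + j + e)))
            + (1ℚ - (1ℚ + δ) * ε) * (δ * j - y - (δ - 1ℚ) * σ * j)
        eq = solve-∀ ℚ-ring
      assemble : (Σ ℚ λ τ → 0ℚ ≤ τ × 0ℚ ≤ 1ℚ - τ × y ≡ (1ℚ - τ) * - j + τ * t) → Hull 0 e j z
      assemble (τ , 0≤τ , τ≤1 , y≡) = record
        { weight = 0ℚ ∷ 0ℚ ∷ 0ℚ ∷ 0ℚ ∷ (1ℚ - σ) * j * (1ℚ - τ) ∷ (1ℚ - σ) * j * τ ∷ σ * j * (1ℚ - τ) ∷ σ * j * τ ∷ []
        ; weight≥0 = λ { zero → ℚₚ.≤-refl ; (suc zero) → ℚₚ.≤-refl ; (suc (suc zero)) → ℚₚ.≤-refl ; (suc (suc (suc zero))) → ℚₚ.≤-refl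
                       ; (suc (suc (suc (suc zero)))) → σ≤1 ⊗ 0≤j ⊗ τ≤1 ; (suc (suc (suc (suc (suc zero))))) → σ≤1 ⊗ 0≤j ⊗ 0≤τ
                       ; (suc (suc (suc (suc (suc (suc zero)))))) → 0≤σ ⊗ 0≤j ⊗ τ≤1
                       ; (suc (suc (suc (suc (suc (suc (suc zero))))))) → 0≤σ ⊗ 0≤j ⊗ 0≤τ }
        ; sum≡j = total j σ τ
        ; shift = e
        ; shift≥0 = 0≤e
        ; shift≤e = ℚₚ.≤-reflexive (sym (ℚₚ.+-inverseʳ e))
        ; point = λ { zero → trans x≡ (x-eq δ e j σ τ) ; (suc zero) → trans y≡ (y-eq η δ ε e j σ τ) }
        }
        where
        total : ∀ j σ τ → 0ℚ + (0ℚ + (0ℚ + (0ℚ + ((1ℚ - σ) * j * (1ℚ - τ) + ((1ℚ - σ) * j * τ + (σ * j * (1ℚ - τ) + (σ * j * τ + 0ℚ))))))) ≡ j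
        total = solve-∀ ℚ-ring
        x-eq : ∀ δ e j σ τ → (1ℚ - σ) * (j + j + e) + σ * (e + (1ℚ + 1ℚ + δ) * j) ≡ 0ℚ * 0ℚ + (0ℚ * 0ℚ + (0ℚ * 1ℚ + (0ℚ * 1ℚ
          + ((1ℚ - σ) * j * (1ℚ - τ) * (1ℚ + 1ℚ) + ((1ℚ - σ) * j * τ * (1ℚ + 1ℚ) + (σ * j * (1ℚ - τ) * (1ℚ + 1ℚ + δ) + (σ * j * τ * (1ℚ + 1ℚ + δ) + 0ℚ))))))) + e * 1ℚ
        x-eq = solve-∀ ℚ-ring
        y-eq : ∀ η δ ε e j σ τ → (1ℚ - τ) * - j + τ * ((1ℚ - σ) * j * (δ + ε) + σ * j) ≡
          0ℚ * - η + (0ℚ * δ + (0ℚ * - 1ℚ + (0ℚ * (δ + ε)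
          + ((1ℚ - σ) * j * (1ℚ - τ) * - 1ℚ + ((1ℚ - σ) * j * τ * (δ + ε) + (σ * j * (1ℚ - τ) * - 1ℚ + (σ * j * τ * 1ℚ + 0ℚ))))))) + e * 0ℚ
        y-eq = solve-∀ ℚ-ring

  -- The shift of a slice can be as large as e + a. What fits into e remains a shift; the excess, at
  -- most a, becomes the weight of the second vertex over height 1.
  region⇒hull : ∀ m {e j z} → 0ℚ ≤ e → 0ℚ ≤ j → Region m e j z → Hull m e j z
  region⇒hull zero {z = z} 0≤e 0≤j R = baseRegion⇒hull {z = z} 0≤e 0≤j R
  region⇒hull (suc m) {e} {j} {z} 0≤e 0≤j (0≤a , a≤j , R)
    with region⇒hull m {e + z zero} {j - z zero} {tail z} (0≤e ⊕ 0≤a) a≤j R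
  ... | H = [ small , large ]′ (ℚₚ.≤-total shift e)
    where
    open Hull H
    a = z zero
    build : ∀ d μ → 0ℚ ≤ μ → 0ℚ ≤ a - μ → 0ℚ ≤ d → 0ℚ ≤ e - d → shift ≡ μ + d → Hull (suc m) e j z
    build d μ 0≤μ μ≤a 0≤d d≤e eq = record
      { weight = (a - μ) ∷ μ ∷ weight
      ; weight≥0 = λ { zero → μ≤a ; (suc zero) → 0≤μ ; (suc (suc i)) → weight≥0 i }
      ; sum≡j = trans (cong (λ s → (a - μ) + (μ + s)) sum≡j) (total a μ j)
      ; shift = d
      ; shift≥0 = 0≤d
      ; shift≤e = d≤e
      ; point = λ { zero → sym (trans (cong (λ s → (a - μ) * 1ℚ + (μ * 1ℚ + s) + d * 0ℚ) (sumℚ-*0 weight)) (head a μ d))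
                  ; (suc c) → trans (point c) (trans (cong (λ s → sumℚ (λ i → weight i * vertices m i c) + s * xDir m c) eq) (move a μ d (xDir m c) _)) }
      }
      where
      total : ∀ a μ j → (a - μ) + (μ + (j - a)) ≡ j
      total = solve-∀ ℚ-ring
      head : ∀ a μ d → (a - μ) * 1ℚ + (μ * 1ℚ + 0ℚ) + d * 0ℚ ≡ a
      head = solve-∀ ℚ-ring
      move : ∀ a μ d v s → s + (μ + d) * v ≡ (a - μ) * 0ℚ + (μ * v + s) + d * v
      move = solve-∀ ℚ-ring
    small : shift ≤ e → Hull (suc m) e j z
    small s≤e = build shift 0ℚ ℚₚ.≤-refl (0≤a by eq a) shift≥0 (≤⇒0≤- s≤e) (sym (ℚₚ.+-identityˡ shift))
      where
      eq : ∀ a → a - 0ℚ ≡ a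
      eq = solve-∀ ℚ-ring
    large : e ≤ shift → Hull (suc m) e j z
    large e≤s = build e (shift - e) (≤⇒0≤- e≤s) (shift≤e by eq a e shift) 0≤e (ℚₚ.≤-reflexive (sym (ℚₚ.+-inverseʳ e))) (sym (eq′ e shift))
      where
      eq : ∀ a e s → a - (s - e) ≡ e + a - s
      eq = solve-∀ ℚ-ring
      eq′ : ∀ e s → s - e + e ≡ s
      eq′ = solve-∀ ℚ-ring

  -- Within one strip a single lower and a single upper bound for y imply the others, as the
  -- boundaries are concave above and convex below. This is what allows lattice points to be counted
  -- column by column.
  left-strip : ∀ {e j x y} → 0ℚ ≤ e → 0ℚ ≤ j → 0ℚ ≤ x → 0ℚ ≤ j - x →
    0ℚ ≤ (1ℚ + π) * (y + x) + j - x → 0ℚ ≤ (1ℚ + δ) * (δ * j - y) + x → BaseRegion e j x y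
  left-strip {e} {j} {x} {y} 0≤e 0≤j 0≤x x≤j LL UL = record
    { left = 0≤x
    ; right = 0≤e ⊕ x≤j ⊕ 0≤D ⊗ 0≤j by right-eq δ e j x
    ; lower-left = LL
    ; lower = 0≤η ⊗ LL ⊕ 0≤1-η ⊗ x≤j ⊕ η-defect (y + x) by lower-eq π η j x y
    ; upper-left = UL
    ; upper = UL ⊕ x≤j by upper-eq δ j x y
    ; upper-right = UL ⊕ x≤j ⊕ 0≤δ ⊗ (x≤j ⊕ 0≤j ⊕ 0≤e) by upper-right-eq δ e j x y
    }
    where
    right-eq : ∀ δ e j x → e + (1ℚ + 1ℚ + δ) * j - x ≡ e + (j - x) + (1ℚ + δ) * j
    right-eq = solve-∀ ℚ-ring
    lower-eq : ∀ π η j x y → y + j ≡ η * ((1ℚ + π) * (y + x) + j - x) + (1ℚ - η) * (j - x) + (1ℚ - (1ℚ + π) * η) * (y + x)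
    lower-eq = solve-∀ ℚ-ring
    upper-eq : ∀ δ j x y → (1ℚ + δ) * (δ * j - y) + j ≡ (1ℚ + δ) * (δ * j - y) + x + (j - x)
    upper-eq = solve-∀ ℚ-ring
    upper-right-eq : ∀ δ e j x y → (1ℚ + δ) * (δ * j - y) + j - δ * (x - (j + j + e)) ≡
      (1ℚ + δ) * (δ * j - y) + x + (j - x) + δ * (j - x + j + e)
    upper-right-eq = solve-∀ ℚ-ring

  mid-strip : ∀ {e j x y} → 0ℚ ≤ j → 0ℚ ≤ x - j → 0ℚ ≤ j + j + e - x →
    0ℚ ≤ y + j → 0ℚ ≤ (1ℚ + δ) * (δ * j - y) + j → BaseRegion e j x y
  mid-strip {e} {j} {x} {y} 0≤j j≤x x≤2j+e L U = record
    { left = j≤x ⊕ 0≤j by left-eq j x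
    ; right = x≤2j+e ⊕ 0≤δ ⊗ 0≤j by right-eq δ e j x
    ; lower-left = 0≤P ⊗ L ⊕ 0≤π ⊗ j≤x by lower-left-eq π j x y
    ; lower = L
    ; upper-left = U ⊕ j≤x by upper-left-eq δ j x y
    ; upper = U
    ; upper-right = U ⊕ 0≤δ ⊗ x≤2j+e by upper-right-eq δ e j x y
    }
    where
    left-eq : ∀ j x → x ≡ x - j + j
    left-eq = solve-∀ ℚ-ring
    right-eq : ∀ δ e j x → e + (1ℚ + 1ℚ + δ) * j - x ≡ j + j + e - x + δ * j
    right-eq = solve-∀ ℚ-ring
    lower-left-eq : ∀ π j x y → (1ℚ + π) * (y + x) + j - x ≡ (1ℚ + π) * (y + j) + π * (x - j)
    lower-left-eq = solve-∀ ℚ-ring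
    upper-left-eq : ∀ δ j x y → (1ℚ + δ) * (δ * j - y) + x ≡ (1ℚ + δ) * (δ * j - y) + j + (x - j)
    upper-left-eq = solve-∀ ℚ-ring
    upper-right-eq : ∀ δ e j x y → (1ℚ + δ) * (δ * j - y) + j - δ * (x - (j + j + e)) ≡ (1ℚ + δ) * (δ * j - y) + j + δ * (j + j + e - x)
    upper-right-eq = solve-∀ ℚ-ring

  right-strip : ∀ {e j x y} → 0ℚ ≤ e → 0ℚ ≤ j → 0ℚ ≤ x - (j + j + e) → 0ℚ ≤ e + (1ℚ + 1ℚ + δ) * j - x →
    0ℚ ≤ y + j → 0ℚ ≤ (1ℚ + δ) * (δ * j - y) + j - δ * (x - (j + j + e)) → BaseRegion e j x y
  right-strip {e} {j} {x} {y} 0≤e 0≤j 2j+e≤x R L UR = record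
    { left = 2j+e≤x ⊕ 0≤j ⊕ 0≤j ⊕ 0≤e by left-eq e j x
    ; right = R
    ; lower-left = 0≤P ⊗ L ⊕ 0≤π ⊗ (2j+e≤x ⊕ 0≤j ⊕ 0≤e) by lower-left-eq π e j x y
    ; lower = L
    ; upper-left = UR ⊕ 0≤δ ⊗ 2j+e≤x ⊕ (2j+e≤x ⊕ 0≤j ⊕ 0≤e) by upper-left-eq δ e j x y
    ; upper = UR ⊕ 0≤δ ⊗ 2j+e≤x by upper-eq δ e j x y
    ; upper-right = UR
    }
    where
    left-eq : ∀ e j x → x ≡ x - (j + j + e) + j + j + e
    left-eq = solve-∀ ℚ-ring
    lower-left-eq : ∀ π e j x y → (1ℚ + π) * (y + x) + j - x ≡ (1ℚ + π) * (y + j) + π * (x - (j + j + e) + j + e)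
    lower-left-eq = solve-∀ ℚ-ring
    upper-left-eq : ∀ δ e j x y → (1ℚ + δ) * (δ * j - y) + x ≡
      (1ℚ + δ) * (δ * j - y) + j - δ * (x - (j + j + e)) + δ * (x - (j + j + e)) + (x - (j + j + e) + j + e)
    upper-left-eq = solve-∀ ℚ-ring
    upper-eq : ∀ δ e j x y → (1ℚ + δ) * (δ * j - y) + j ≡
      (1ℚ + δ) * (δ * j - y) + j - δ * (x - (j + j + e)) + δ * (x - (j + j + e))
    upper-eq = solve-∀ ℚ-ring

  -- The dilates and the dimension of the polytope

  𝒫 : ∀ m → RatPolytope (suc (suc m))
  𝒫 m = polytope (#verts m) (vertices m)

  inDilate⇒region : ∀ m k {z} → InDilate (𝒫 m) k z → Region m 0ℚ (ℕ→ℚ k) z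
  inDilate⇒region m k (lam , lam≥0 , sum≡1 , z≡) = hull⇒region m record
    { weight = λ i → ℕ→ℚ k * lam i
    ; weight≥0 = λ i → ℕ→ℚ-nonneg k ⊗ lam≥0 i
    ; sum≡j = trans (sym (*-sumℚ (ℕ→ℚ k) lam)) (trans (cong (ℕ→ℚ k *_) sum≡1) (ℚₚ.*-identityʳ _))
    ; shift = 0ℚ
    ; shift≥0 = ℚₚ.≤-refl
    ; shift≤e = ℚₚ.≤-refl
    ; point = λ c → trans (z≡ c) (trans (*-sumℚ (ℕ→ℚ k) (λ i → lam i * vertices m i c))
        (trans (sumℚ-cong (λ i → sym (ℚₚ.*-assoc (ℕ→ℚ k) (lam i) (vertices m i c)))) (no-shift _ (xDir m c))))
    }
    where
    no-shift : ∀ s v → s ≡ s + 0ℚ * v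
    no-shift = solve-∀ ℚ-ring

  region⇒inDilate : ∀ m k {z} → 1 ℕ.≤ k → Region m 0ℚ (ℕ→ℚ k) z → InDilate (𝒫 m) k z
  region⇒inDilate m k@(suc k′) {z} _ R =
      (λ i → r * weight i)
    , (λ i → 0≤r ⊗ weight≥0 i)
    , trans (sym (*-sumℚ r weight)) (trans (cong (r *_) sum≡j) (trans (ℚₚ.*-comm r _) k*r))
    , λ c → trans (point c) (trans (cong (λ s → combination c + s * xDir m c) shift≡0)
        (trans (rescale (ℕ→ℚ k) r (combination c) (xDir m c) k*r)
               (cong (ℕ→ℚ k *_) (trans (*-sumℚ r (λ i → weight i * vertices m i c))
                                       (sumℚ-cong (λ i → sym (ℚₚ.*-assoc r (weight i) (vertices m i c))))))))
    where
    r : ℚ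
    r = proj₁ (reciprocal k′)
    0≤r : 0ℚ ≤ r
    0≤r = proj₁ (proj₂ (reciprocal k′))
    k*r : ℕ→ℚ k * r ≡ 1ℚ
    k*r = proj₂ (proj₂ (reciprocal k′))
    open Hull (region⇒hull m {z = z} ℚₚ.≤-refl (ℕ→ℚ-nonneg k) R)
    combination : ∀ c → ℚ
    combination c = sumℚ (λ i → weight i * vertices m i c)
    rescale : ∀ a r s v → a * r ≡ 1ℚ → s + 0ℚ * v ≡ a * (r * s)
    rescale a r s v a*r≡1 = trans (expand s v) (trans (cong (_* s) (sym a*r≡1)) (ℚₚ.*-assoc a r s))
      where
      expand : ∀ s v → s + 0ℚ * v ≡ 1ℚ * s
      expand = solve-∀ ℚ-ring
    shift≡0 : shift ≡ 0ℚ
    shift≡0 = ℚₚ.≤-antisym (0≤-⇒≤ shift≤e) shift≥0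

  -- The base triangle (1, -1), (2, -1), (2 + δ, 1) is nondegenerate even for δ = 0, where some of
  -- the eight vertices coincide. Each further dimension adds the only chosen vertex whose first
  -- coordinate is not 0, so that coordinate isolates its coefficient.
  simplex : ∀ m → Fin (suc (suc (suc m))) → Fin (#verts m)
  simplex zero = suc (suc zero) ∷ suc (suc (suc (suc zero))) ∷ suc (suc (suc (suc (suc (suc (suc zero)))))) ∷ []
  simplex (suc m) = suc (suc (simplex m zero)) ∷ zero ∷ λ i → suc (suc (simplex m (suc i)))

  𝒫-fullDim : ∀ m → FullDim (𝒫 m)
  𝒫-fullDim m = simplex m , independent m
    where
    independent : ∀ m (μ : Fin (suc (suc m)) → ℚ) →
      (∀ c → sumℚ (λ i → μ i * (vertices m (simplex m (suc i)) c - vertices m (simplex m zero) c)) ≡ 0ℚ) → ∀ i → μ i ≡ 0ℚ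
    independent zero μ eqs = λ { zero → μ₀≡0 ; (suc zero) → μ₁≡0 }
      where
      -- At the call h is ½. Writing h + h for 1 makes the identity valid for every h, and ½ + ½
      -- computes to 1.
      half : ∀ h a b → (h + h) * b ≡ h * (a * (- 1ℚ - - 1ℚ) + (b * (1ℚ - - 1ℚ) + 0ℚ))
      half = solve-∀ ℚ-ring
      μ₁≡0 : μ (suc zero) ≡ 0ℚ
      μ₁≡0 = trans (sym (ℚₚ.*-identityˡ (μ (suc zero)))) (trans (half ℚ.½ (μ zero) (μ (suc zero))) (trans (cong (ℚ.½ *_) (eqs (suc zero))) (ℚₚ.*-zeroʳ ℚ.½)))
      unit : ∀ a b δ → a ≡ a * (1ℚ + 1ℚ - 1ℚ) + (b * (1ℚ + 1ℚ + δ - 1ℚ) + 0ℚ) - b * (1ℚ + δ)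
      unit = solve-∀ ℚ-ring
      μ₀≡0 : μ zero ≡ 0ℚ
      μ₀≡0 = trans (unit (μ zero) (μ (suc zero)) δ) (trans (cong₂ (λ s t → s - t * (1ℚ + δ)) (eqs zero) μ₁≡0) (vanish δ))
        where
        vanish : ∀ δ → 0ℚ - 0ℚ * (1ℚ + δ) ≡ 0ℚ
        vanish = solve-∀ ℚ-ring
    independent (suc m) μ eqs = λ { zero → μ₀≡0 ; (suc i) → independent m (λ i → μ (suc i)) eqs′ i }
      where
      head : ∀ a → a ≡ a * (1ℚ - 0ℚ) + 0ℚ
      head = solve-∀ ℚ-ring
      μ₀≡0 : μ zero ≡ 0ℚ
      μ₀≡0 = trans (head (μ zero)) (trans (cong (λ s → μ zero * (1ℚ - 0ℚ) + s) (sym (sumℚ-*0 (λ i → μ (suc i))))) (eqs zero))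
      drop : ∀ a s → s ≡ 0ℚ * a + s
      drop = solve-∀ ℚ-ring
      eqs′ : ∀ c → sumℚ (λ i → μ (suc i) * (vertices m (simplex m (suc i)) c - vertices m (simplex m zero) c)) ≡ 0ℚ
      eqs′ c = trans (drop (0ℚ - vertices m (simplex m zero) c) (sumℚ (λ i → μ (suc i) * (vertices m (simplex m (suc i)) c - vertices m (simplex m zero) c))))
        (trans (cong (λ a → a * (0ℚ - vertices m (simplex m zero) c)
                            + sumℚ (λ i → μ (suc i) * (vertices m (simplex m (suc i)) c - vertices m (simplex m zero) c))) (sym μ₀≡0))
               (eqs (suc c)))

-- Integer bounds and floors

ℤ→ℚ-neg : ∀ a → ℤ→ℚ (ℤ.- a) ≡ - ℤ→ℚ a
ℤ→ℚ-neg a = trans (pad (ℤ→ℚ (ℤ.- a)) (ℤ→ℚ a))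
  (trans (cong (λ s → s - ℤ→ℚ a) (trans (sym (ℤ→ℚ-+ (ℤ.- a) a)) (cong ℤ→ℚ (ℤₚ.+-inverseˡ a)))) (ℚₚ.+-identityˡ _))
  where
  pad : ∀ x y → x ≡ (x + y) - y
  pad = solve-∀ ℚ-ring

ℕ→ℚ-∸ : ∀ {a b} → b ℕ.≤ a → ℕ→ℚ (a ∸ b) ≡ ℕ→ℚ a - ℕ→ℚ b
ℕ→ℚ-∸ {a} {b} b≤a = trans (pad (ℕ→ℚ (a ∸ b)) (ℕ→ℚ b))
  (cong (λ s → s - ℕ→ℚ b) (trans (sym (ℕ→ℚ-+ (a ∸ b) b)) (cong ℕ→ℚ (ℕₚ.m∸n+n≡m b≤a))))
  where
  pad : ∀ x y → x ≡ (x + y) - y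
  pad = solve-∀ ℚ-ring

ℕ→ℚ-mono-≤ : ∀ {a b} → a ℕ.≤ b → ℕ→ℚ a ≤ ℕ→ℚ b
ℕ→ℚ-mono-≤ a≤b = ℤ→ℚ-mono-≤ (ℤ.+≤+ a≤b)

ℕ→ℚ-cancel-≤ : ∀ {a b} → ℕ→ℚ a ≤ ℕ→ℚ b → a ℕ.≤ b
ℕ→ℚ-cancel-≤ = ℤₚ.drop‿+≤+ ∘ ℤ→ℚ-cancel-≤

nonneg-ℤ : ∀ {z} → 0ℚ ≤ ℤ→ℚ z → ∃ λ n → z ≡ + n
nonneg-ℤ {+ n} _ = n , refl
nonneg-ℤ { -[1+ n ]} 0≤z with ℤ→ℚ-cancel-≤ {+ 0} { -[1+ n ]} 0≤z
... | ()

ℕ→ℚ-/ : ∀ p N → ℕ→ℚ N ≡ ℕ→ℚ (N DivMod.% suc p) + ℕ→ℚ (N DivMod./ suc p) * (1ℚ + ℕ→ℚ p)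
ℕ→ℚ-/ p N = trans (cong ℕ→ℚ (DivMod.m≡m%n+[m/n]*n N (suc p)))
  (trans (ℕ→ℚ-+ r (q ℕ.* suc p)) (cong (λ s → ℕ→ℚ r + s) (trans (ℕ→ℚ-* q (suc p)) (cong (λ s → ℕ→ℚ q * s) (ℕ→ℚ-suc p)))))
  where
  q = N DivMod./ suc p
  r = N DivMod.% suc p

-- For a natural v this is the maximality of the quotient; a negative v lies below every quotient.
≤floor : ∀ p N v → 0ℚ ≤ (1ℚ + ℕ→ℚ p) * - ℤ→ℚ v + ℕ→ℚ N → 0ℚ ≤ ℕ→ℚ (N DivMod./ suc p) - ℤ→ℚ v
≤floor p N (+ a) h = ≤⇒0≤- (ℕ→ℚ-mono-≤ a≤)
  where
  eq : ∀ P a n → n - a * P ≡ P * - a + n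
  eq = solve-∀ ℚ-ring
  a*p≤N : a ℕ.* suc p ℕ.≤ N
  a*p≤N = ℕ→ℚ-cancel-≤ (0≤-⇒≤ (h by trans (cong (λ s → ℕ→ℚ N - s) (trans (ℕ→ℚ-* a (suc p)) (cong (ℕ→ℚ a *_) (ℕ→ℚ-suc p)))) (eq (1ℚ + ℕ→ℚ p) (ℕ→ℚ a) (ℕ→ℚ N))))
  a≤ : a ℕ.≤ N DivMod./ suc p
  a≤ = subst (ℕ._≤ _) (DivMod.m*n/n≡m a (suc p)) (DivMod./-monoˡ-≤ (suc p) a*p≤N)
≤floor p N v@(-[1+ a ]) _ = ℕ→ℚ-nonneg (N DivMod./ suc p) ⊕ ℕ→ℚ-nonneg (suc a) by cong (λ s → ℕ→ℚ (N DivMod./ suc p) + s) (sym (ℤ→ℚ-neg v))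

floor≤ : ∀ p N v → 0ℚ ≤ ℕ→ℚ (N DivMod./ suc p) - v → 0ℚ ≤ (1ℚ + ℕ→ℚ p) * - v + ℕ→ℚ N
floor≤ p N v h = (0≤1 ⊕ ℕ→ℚ-nonneg p) ⊗ h ⊕ ℕ→ℚ-nonneg (N DivMod.% suc p)
  by trans (cong (λ s → (1ℚ + ℕ→ℚ p) * - v + s) (ℕ→ℚ-/ p N)) (eq (1ℚ + ℕ→ℚ p) (ℕ→ℚ (N DivMod./ suc p)) v (ℕ→ℚ (N DivMod.% suc p)))
  where
  eq : ∀ P q v r → P * - v + (r + q * P) ≡ P * (q - v) + r
  eq = solve-∀ ℚ-ring

-- Counting lattice points by slices

sumℕ : ℕ → (ℕ → ℕ) → ℕ
sumℕ zero    f = 0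
sumℕ (suc n) f = sumℕ n f ℕ.+ f n

Counted : ∀ {n} → (ZPt n → Set) → ℕ → Set
Counted {n} S N = Σ (Fin N → ZPt n) λ f →
  (∀ i → S (f i)) × (∀ i j → f i ≗ᶻ f j → i ≡ j) × (∀ z → S z → ∃ λ i → f i ≗ᶻ z)

counted-⇔ : ∀ {n N} {S T : ZPt n → Set} → (∀ z → S z → T z) → (∀ z → T z → S z) → Counted S N → Counted T N
counted-⇔ S⇒T T⇒S (f , f∈ , f-inj , f-surj) = f , (λ i → S⇒T _ (f∈ i)) , f-inj , λ z z∈T → f-surj z (T⇒S z z∈T)

counted-∪ : ∀ {n M N} {S T : ZPt n → Set} → Counted S M → Counted T N → (∀ z w → S z → T w → ¬ z ≗ᶻ w) →
            Counted (λ z → S z ⊎ T z) (M ℕ.+ N)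
counted-∪ {n} {M} {N} {S} {T} (f , f∈ , f-inj , f-surj) (g , g∈ , g-inj , g-surj) disjoint =
    h ∘ Fin.splitAt M
  , h∈ ∘ Fin.splitAt M
  , (λ i j eq → trans (sym (Finₚ.join-splitAt M N i)) (trans (cong (Fin.join M N) (h-inj (Fin.splitAt M i) (Fin.splitAt M j) eq)) (Finₚ.join-splitAt M N j)))
  , surj
  where
  h : Fin M ⊎ Fin N → ZPt n
  h = [ f , g ]′
  h∈ : ∀ s → S (h s) ⊎ T (h s)
  h∈ (inj₁ i) = inj₁ (f∈ i)
  h∈ (inj₂ i) = inj₂ (g∈ i)
  h-inj : ∀ s t → h s ≗ᶻ h t → s ≡ t
  h-inj (inj₁ i) (inj₁ j) eq = cong inj₁ (f-inj i j eq)
  h-inj (inj₁ i) (inj₂ j) eq = contradiction eq (disjoint _ _ (f∈ i) (g∈ j))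
  h-inj (inj₂ i) (inj₁ j) eq = contradiction (λ c → sym (eq c)) (disjoint _ _ (f∈ j) (g∈ i))
  h-inj (inj₂ i) (inj₂ j) eq = cong inj₂ (g-inj i j eq)
  index : ∀ {z} s → h s ≗ᶻ z → ∃ λ i → h (Fin.splitAt M i) ≗ᶻ z
  index s eq = Fin.join M N s , subst (λ s → h s ≗ᶻ _) (sym (Finₚ.splitAt-join M N s)) eq
  surj : ∀ z → S z ⊎ T z → ∃ λ i → h (Fin.splitAt M i) ≗ᶻ z
  surj z (inj₁ z∈S) = let i , eq = f-surj z z∈S in index (inj₁ i) eq
  surj z (inj₂ z∈T) = let i , eq = g-surj z z∈T in index (inj₂ i) eq

counted-fibre : ∀ {n N} {S : ZPt n → Set} a → Counted S N → Counted (λ z → z zero ≡ a × S (tail z)) N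
counted-fibre a (f , f∈ , f-inj , f-surj) =
    (λ i → a ∷ f i)
  , (λ i → refl , f∈ i)
  , (λ i j eq → f-inj i j (λ c → eq (suc c)))
  , λ z (z₀≡a , z∈S) → let i , eq = f-surj (tail z) z∈S in i , λ { zero → sym z₀≡a ; (suc c) → eq c }

-- The offset `b` lets each strip number its columns from its own first one.
counted-fibres : ∀ {n} (F : ℕ → ZPt n → Set) (N : ℕ → ℕ) b M → (∀ a → a ℕ.< M → Counted (F a) (N a)) →
                 Counted (λ z → ∃ λ a → a ℕ.< M × z zero ≡ + (b ℕ.+ a) × F a (tail z)) (sumℕ M N)
counted-fibres F N b zero cnt = (λ ()) , (λ ()) , (λ ()) , λ { z (a , () , _) }
counted-fibres F N b (suc M) cnt = counted-⇔ to from
  (counted-∪ (counted-fibres F N b M (λ a a<M → cnt a (ℕₚ.m<n⇒m<1+n a<M))) (counted-fibre (+ (b ℕ.+ M)) (cnt M ℕₚ.≤-refl)) disjoint)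
  where
  to : ∀ z → _ → _
  to z (inj₁ (a , a<M , z∈)) = a , ℕₚ.m<n⇒m<1+n a<M , z∈
  to z (inj₂ z∈) = M , ℕₚ.≤-refl , z∈
  from : ∀ z → _ → _
  from z (a , a<1+M , z∈) with ℕₚ.m<1+n⇒m<n∨m≡n a<1+M
  ... | inj₁ a<M = inj₁ (a , a<M , z∈)
  ... | inj₂ refl = inj₂ z∈
  disjoint : ∀ z w → _ → _ → ¬ z ≗ᶻ w
  disjoint z w (a , a<M , z₀≡ , _) (w₀≡ , _) eq =
    ℕₚ.<⇒≢ a<M (ℕₚ.+-cancelˡ-≡ b a M (ℤₚ.+-injective (trans (sym z₀≡) (trans (eq zero) w₀≡))))

-- Two natural bounds suffice because every column of the polygon contains y = 0; no column is
-- empty, and its count needs no case distinction.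
Between : ℕ → ℕ → ZPt 1 → Set
Between lo hi z = 0ℚ ≤ ℤ→ℚ (z zero) + ℕ→ℚ lo × 0ℚ ≤ ℕ→ℚ hi - ℤ→ℚ (z zero)

counted-between : ∀ lo hi → Counted (Between lo hi) (suc (lo ℕ.+ hi))
counted-between lo hi = f , f∈ , f-inj , f-surj
  where
  f : Fin (suc (lo ℕ.+ hi)) → ZPt 1
  f i = (+ Fin.toℕ i ℤ.- + lo) ∷ []
  cast : ∀ a → ℤ→ℚ (+ a ℤ.- + lo) ≡ ℕ→ℚ a - ℕ→ℚ lo
  cast a = trans (ℤ→ℚ-+ (+ a) (ℤ.- + lo)) (cong (λ s → ℕ→ℚ a + s) (ℤ→ℚ-neg (+ lo)))
  up : ∀ a b → a - b + b ≡ a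
  up = solve-∀ ℚ-ring
  down : ∀ a b c → c - (a - b) ≡ (b + c) - a
  down = solve-∀ ℚ-ring
  f∈ : ∀ i → Between lo hi (f i)
  f∈ i = (ℕ→ℚ-nonneg (Fin.toℕ i) by trans (cong (_+ ℕ→ℚ lo) (cast (Fin.toℕ i))) (up _ (ℕ→ℚ lo)))
       , (≤⇒0≤- (ℕ→ℚ-mono-≤ (ℕₚ.m<1+n⇒m≤n (Finₚ.toℕ<n i)))
          by trans (cong (λ s → ℕ→ℚ hi - s) (cast (Fin.toℕ i)))
             (trans (down _ (ℕ→ℚ lo) (ℕ→ℚ hi)) (cong (λ s → s - ℕ→ℚ (Fin.toℕ i)) (sym (ℕ→ℚ-+ lo hi)))))
  f-inj : ∀ i j → f i ≗ᶻ f j → i ≡ j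
  f-inj i j eq = Finₚ.toℕ-injective (ℤₚ.+-injective (ℤ-group.∙-cancelʳ (ℤ.- + lo) _ _ (eq zero)))
  f-surj : ∀ z → Between lo hi z → ∃ λ i → f i ≗ᶻ z
  f-surj z (lo≤z , z≤hi) with nonneg-ℤ {z zero ℤ.+ + lo} (lo≤z by ℤ→ℚ-+ (z zero) (+ lo))
  ... | a , z+lo≡a = Fin.fromℕ< a< , λ { zero → trans (cong (λ b → + b ℤ.- + lo) (Finₚ.toℕ-fromℕ< a<)) (trans (cong (λ b → b ℤ.- + lo) (sym z+lo≡a)) (ℤ-group.//-rightDividesʳ (+ lo) (z zero))) }
    where
    swap : ∀ l h z → (l + h) - (z + l) ≡ h - z
    swap = solve-∀ ℚ-ring
    a< : a ℕ.< suc (lo ℕ.+ hi)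
    a< = ℕ.s≤s (ℕ→ℚ-cancel-≤ (0≤-⇒≤ (z≤hi by trans
      (cong₂ _-_ (ℕ→ℚ-+ lo hi) (trans (cong ℤ→ℚ (sym z+lo≡a)) (ℤ→ℚ-+ (z zero) (+ lo)))) (swap (ℕ→ℚ lo) (ℕ→ℚ hi) (ℤ→ℚ (z zero))))))

-- Minimum periods on ℕ and on ℤ

MinPeriodℕ : (ℕ → ℚ) → ℕ → Set
MinPeriodℕ u p =
  1 ℕ.≤ p × (∀ k → u (k ℕ.+ p) ≡ u k) × (∀ q → 1 ℕ.≤ q → q ℕ.< p → ¬ (∀ k → u (k ℕ.+ q) ≡ u k))

minPeriodℕ-+const : ∀ {u p} a → MinPeriodℕ u p → MinPeriodℕ (λ k → u k + a) p
minPeriodℕ-+const {u} a (1≤p , period , minimal) =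
    1≤p
  , (λ k → cong (λ s → s + a) (period k))
  , λ q 1≤q q<p eq → minimal q 1≤q q<p (λ k → ℚ-group.∙-cancelʳ a (u (k ℕ.+ q)) (u k) (eq k))

-- A negative argument −(1 + n) is replaced by the nonnegative −(1 + n) + (1 + n) p = (1 + n)(p − 1).
extend : ℕ → (ℕ → ℚ) → ℤ → ℚ
extend p u (+ k)    = u k
extend p u -[1+ n ] = u (suc n ℕ.* ℕ.pred p)

-- Minimality is inherited, as a period on ℤ is one on ℕ. At a negative argument, the two values to
-- be compared are values of u at natural numbers that differ by a multiple of p.
extend-minPeriod : ∀ {u p} → MinPeriodℕ u p → MinPeriod (extend p u) p
extend-minPeriod {u} {p@(suc π)} (1≤p , period , minimal) =
  1≤p , periodic , λ q 1≤q q<p eq → minimal q 1≤q q<p (λ k → eq (+ k))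
  where
  multiple : ∀ k a → u (k ℕ.+ a ℕ.* p) ≡ u k
  multiple k zero = cong u (ℕₚ.+-identityʳ k)
  multiple k (suc a) = trans (cong u (regroup k a π)) (trans (period (k ℕ.+ a ℕ.* p)) (multiple k a))
    where
    regroup : ∀ k a π → k ℕ.+ suc a ℕ.* suc π ≡ k ℕ.+ a ℕ.* suc π ℕ.+ suc π
    regroup = ring-ℕ
  periodic : ∀ t → extend p u (t ℤ.+ + p) ≡ extend p u t
  periodic (+ k) = period k
  periodic -[1+ n ] with n ℕ.≤? π
  ... | yes n≤π = trans (cong (extend p u) (trans (ℤₚ.[1+m]⊖[1+n]≡m⊖n π n) (ℤₚ.⊖-≥ n≤π)))
      (trans (sym (multiple (π ∸ n) n)) (cong u wrap))
    where
    regroup : ∀ d n → d ℕ.+ n ℕ.* suc (d ℕ.+ n) ≡ suc n ℕ.* (d ℕ.+ n)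
    regroup = ring-ℕ
    wrap : (π ∸ n) ℕ.+ n ℕ.* suc π ≡ suc n ℕ.* π
    wrap = subst (λ π′ → (π ∸ n) ℕ.+ n ℕ.* suc π′ ≡ suc n ℕ.* π′) (ℕₚ.m∸n+n≡m n≤π) (regroup (π ∸ n) n)
  ... | no n≰π = trans (cong (extend p u) (trans (ℤₚ.[1+m]⊖[1+n]≡m⊖n π n) (trans (ℤₚ.⊖-< π<n) (cong (λ a → ℤ.- + a) n∸π≡))))
      (trans (sym (multiple (suc d ℕ.* π) π)) (cong u wrap))
    where
    π<n = ℕₚ.≰⇒> n≰π
    d = n ∸ suc π
    n≡ : n ≡ suc π ℕ.+ d
    n≡ = sym (ℕₚ.m+[n∸m]≡n π<n)
    n∸π≡ : n ∸ π ≡ suc d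
    n∸π≡ = trans (cong (λ a → a ∸ π) (trans n≡ (sym (ℕₚ.+-suc π d)))) (ℕₚ.m+n∸m≡n π (suc d))
    regroup : ∀ π d → suc d ℕ.* π ℕ.+ π ℕ.* suc π ≡ suc (suc π ℕ.+ d) ℕ.* π
    regroup = ring-ℕ
    wrap : suc d ℕ.* π ℕ.+ π ℕ.* suc π ≡ suc n ℕ.* π
    wrap = trans (regroup π d) (cong (λ a → suc a ℕ.* π) (sym n≡))

-- Partial sums of quasi-polynomials

S : (ℕ → ℚ) → ℕ → ℚ
S f zero    = f 0
S f (suc k) = S f k + f (suc k)

S-cong : ∀ {f g} → (∀ k → f k ≡ g k) → ∀ k → S f k ≡ S g k
S-cong f≗g zero = f≗g 0
S-cong f≗g (suc k) = cong₂ _+_ (S-cong f≗g k) (f≗g (suc k))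

S-+ : ∀ f g k → S (λ k → f k + g k) k ≡ S f k + S g k
S-+ f g zero = refl
S-+ f g (suc k) = trans (cong (λ s → s + (f (suc k) + g (suc k))) (S-+ f g k)) (interchange (S f k) (S g k) (f (suc k)) (g (suc k)))
  where
  interchange : ∀ a b c d → a + b + (c + d) ≡ a + c + (b + d)
  interchange = solve-∀ ℚ-ring

S-* : ∀ a f k → S (λ k → a * f k) k ≡ a * S f k
S-* a f zero = refl
S-* a f (suc k) = trans (cong (λ s → s + a * f (suc k)) (S-* a f k)) (sym (ℚₚ.*-distribˡ-+ a (S f k) (f (suc k))))

-- R i k is the binomial coefficient C(k + i, i), the basis in which S only shifts coefficients.
R : ℕ → ℕ → ℚ
R zero    k = 1ℚ
R (suc i)   = S (R i)

R-1 : ∀ k → R 1 k ≡ 1ℚ + ℕ→ℚ k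
R-1 zero = refl
R-1 (suc k) = trans (cong (λ s → s + 1ℚ) (R-1 k)) (trans (ℚₚ.+-assoc 1ℚ (ℕ→ℚ k) 1ℚ) (cong (λ s → 1ℚ + s) (trans (ℚₚ.+-comm (ℕ→ℚ k) 1ℚ) (sym (ℕ→ℚ-suc k)))))

-- Absorption for binomial coefficients; it later shows `R (suc i)` to be a polynomial once `R i` is
-- one. Two identities support each other: the induction on k uses `absorb` at the same i, and
-- `absorb` at i + 1 uses `R-suc` at i.
R-suc : ∀ i k → ℕ→ℚ (suc i) * R (suc i) k ≡ (ℕ→ℚ k + ℕ→ℚ (suc i)) * R i k
R-suc i zero = cong (λ s → s * R i 0) (sym (ℚₚ.+-identityˡ (ℕ→ℚ (suc i))))
R-suc i (suc k) = trans (ℚₚ.*-distribˡ-+ (ℕ→ℚ (suc i)) (R (suc i) k) (R i (suc k)))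
  (trans (cong (λ s → s + ℕ→ℚ (suc i) * R i (suc k)) (trans (R-suc i k) (absorb i k)))
  (sym (ℚₚ.*-distribʳ-+ (R i (suc k)) (ℕ→ℚ (suc k)) (ℕ→ℚ (suc i)))))
  where
  absorb : ∀ i k → (ℕ→ℚ k + ℕ→ℚ (suc i)) * R i k ≡ ℕ→ℚ (suc k) * R i (suc k)
  absorb zero k = cong (λ s → s * 1ℚ) (trans (ℚₚ.+-comm (ℕ→ℚ k) 1ℚ) (sym (ℕ→ℚ-suc k)))
  absorb (suc i) k = trans (cong (λ s → (ℕ→ℚ k + s) * R (suc i) k) (ℕ→ℚ-suc (suc i)))
    (trans (regroup (ℕ→ℚ k) (ℕ→ℚ (suc i)) (R (suc i) k) (R i (suc k)))
    (trans (cong (λ s → (1ℚ + ℕ→ℚ k) * R (suc i) k + s - ℕ→ℚ (suc i) * R i (suc k)) (R-suc i (suc k)))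
    (trans (collect (ℕ→ℚ (suc k)) (1ℚ + ℕ→ℚ k) (ℕ→ℚ (suc i)) (R (suc i) k) (R i (suc k)))
    (trans (cong (λ s → s * R (suc i) k + ℕ→ℚ (suc k) * R i (suc k)) (sym (ℕ→ℚ-suc k)))
           (sym (ℚₚ.*-distribˡ-+ (ℕ→ℚ (suc k)) (R (suc i) k) (R i (suc k))))))))
    where
    regroup : ∀ k i r r′ → (k + (1ℚ + i)) * r ≡ (1ℚ + k) * r + i * (r + r′) - i * r′
    regroup = solve-∀ ℚ-ring
    collect : ∀ k k′ i r r′ → k′ * r + (k + i) * r′ - i * r′ ≡ k′ * r + k * r′
    collect = solve-∀ ℚ-ring

-- The starting index is a parameter because summation raises it by one and leaves the coefficients
-- alone.
expand : ∀ {l} → ℕ → Vec ℚ l → ℕ → ℚ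
expand i Vec.[]       k = 0ℚ
expand i (g Vec.∷ gs) k = g * R i k + expand (suc i) gs k

S-0 : ∀ k → S (λ _ → 0ℚ) k ≡ 0ℚ
S-0 zero = refl
S-0 (suc k) = cong (λ s → s + 0ℚ) (S-0 k)

S-expand : ∀ {l} i (gs : Vec ℚ l) k → S (expand i gs) k ≡ expand (suc i) gs k
S-expand i Vec.[] k = S-0 k
S-expand i (g Vec.∷ gs) k = trans (S-+ (λ k → g * R i k) (expand (suc i) gs) k) (cong₂ _+_ (S-* g (R i) k) (S-expand (suc i) gs k))

-- The expansion starts at `R 1`: a multiple of the constant `R 0` is put into `periodic`, whose
-- minimum period it does not change.
record QuasiPoly (p l : ℕ) (f : ℕ → ℚ) : Set where
  constructor quasiPoly
  field
    periodic  : ℕ → ℚ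
    minPeriod : MinPeriodℕ periodic p
    coeffs    : Vec ℚ l
    decompose : ∀ k → f k ≡ periodic k + expand 1 coeffs k

-- All windows of p consecutive values of u have the same sum W, so S u grows by μ = W / p per step
-- on average, and subtracting μ · `R 1` leaves a periodic function. Its differences give back u up
-- to the constant μ, so a shorter period of it would be one of u.
quasiPoly-S : ∀ {p l f} → QuasiPoly p l f → QuasiPoly p (suc l) (S f)
quasiPoly-S {p@(suc π)} {l} {f} (quasiPoly u (1≤p , period , minimal) gs f≡) =
  quasiPoly U (1≤p , U-period , U-minimal) (μ Vec.∷ gs) λ k →
    trans (S-cong f≡ k) (trans (S-+ u (expand 1 gs) k)
      (trans (cong (λ s → S u k + s) (S-expand 1 gs k)) (regroup (S u k) (μ * R 1 k) (expand 2 gs k))))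
  where
  regroup : ∀ a b c → a + c ≡ (a - b) + (b + c)
  regroup = solve-∀ ℚ-ring
  r W μ : ℚ
  r = proj₁ (reciprocal π)
  W = S u p - u 0
  μ = W * r
  U : ℕ → ℚ
  U k = S u k - μ * R 1 k
  window : ∀ k → S u (k ℕ.+ p) ≡ S u k + W
  window zero = cancel (S u p) (u 0)
    where
    cancel : ∀ a b → a ≡ b + (a - b)
    cancel = solve-∀ ℚ-ring
  window (suc k) = trans (cong₂ _+_ (window k) (period (suc k))) (swap (S u k) W (u (suc k)))
    where
    swap : ∀ a b c → a + b + c ≡ a + c + b
    swap = solve-∀ ℚ-ring
  μp : μ * ℕ→ℚ p ≡ W
  μp = trans (ℚₚ.*-assoc W r (ℕ→ℚ p)) (trans (cong (λ s → W * s) (trans (ℚₚ.*-comm r (ℕ→ℚ p)) (proj₂ (proj₂ (reciprocal π))))) (ℚₚ.*-identityʳ W))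
  R-+ : ∀ k → R 1 (k ℕ.+ p) ≡ R 1 k + ℕ→ℚ p
  R-+ k = trans (R-1 (k ℕ.+ p)) (trans (cong (λ s → 1ℚ + s) (ℕ→ℚ-+ k p)) (trans (sym (ℚₚ.+-assoc 1ℚ (ℕ→ℚ k) (ℕ→ℚ p))) (cong (λ s → s + ℕ→ℚ p) (sym (R-1 k)))))
  U-period : ∀ k → U (k ℕ.+ p) ≡ U k
  U-period k = trans (cong₂ (λ s t → s - μ * t) (window k) (R-+ k))
    (trans (distribute (S u k) W μ (R 1 k) (ℕ→ℚ p)) (trans (cong (λ s → S u k - μ * R 1 k + (W - s)) μp) (vanish (S u k - μ * R 1 k) W)))
    where
    distribute : ∀ s w m r p → s + w - m * (r + p) ≡ s - m * r + (w - m * p)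
    distribute = solve-∀ ℚ-ring
    vanish : ∀ s w → s + (w - w) ≡ s
    vanish = solve-∀ ℚ-ring
  u-from-U : ∀ k → u (suc k) ≡ U (suc k) - U k + μ
  u-from-U k = difference (S u k) (u (suc k)) μ (R 1 k)
    where
    difference : ∀ s a m r → a ≡ s + a - m * (r + 1ℚ) - (s - m * r) + m
    difference = solve-∀ ℚ-ring
  U-minimal : ∀ q → 1 ℕ.≤ q → q ℕ.< p → ¬ (∀ k → U (k ℕ.+ q) ≡ U k)
  U-minimal q 1≤q q<p eq = minimal q 1≤q q<p λ { zero → at-0 ; (suc k) → at-suc k }
    where
    at-suc : ∀ k → u (suc k ℕ.+ q) ≡ u (suc k)
    at-suc k = trans (u-from-U (k ℕ.+ q)) (trans (cong₂ (λ s t → s - t + μ) (eq (suc k)) (eq k)) (sym (u-from-U k)))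
    -- Differences reach only positive arguments; the argument 0 is therefore moved to p first.
    at-0 : u q ≡ u 0
    at-0 = trans (sym (period q)) (trans (cong u (ℕₚ.+-comm q p)) (trans (at-suc π) (period 0)))

quasiPoly-≗ : ∀ {p l f g} → (∀ k → g k ≡ f k) → QuasiPoly p l f → QuasiPoly p l g
quasiPoly-≗ g≗f (quasiPoly u mp gs eq) = quasiPoly u mp gs (λ k → trans (g≗f k) (eq k))

quasiPoly-+const : ∀ {p l f} a → QuasiPoly p l f → QuasiPoly p l (λ k → f k + a)
quasiPoly-+const a (quasiPoly u mp gs eq) = quasiPoly (λ k → u k + a) (minPeriodℕ-+const a mp) gs
  (λ k → trans (cong (λ s → s + a) (eq k)) (swap (u k) (expand 1 gs k) a))
  where
  swap : ∀ a b c → a + b + c ≡ a + c + b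
  swap = solve-∀ ℚ-ring

-- ⌊k/p⌋ is (k - k mod p) / p, and k is `R 1` - 1, whence the constant -(α + r) in the periodic
-- part. A period q < p, tested at 0 alone, forces q mod p = q to vanish.
quasiPoly-floor : ∀ π α β → QuasiPoly (suc π) 1 (λ k → ℕ→ℚ (k DivMod./ suc π) + (α * ℕ→ℚ k + β))
quasiPoly-floor π α β = quasiPoly u (ℕ.s≤s ℕ.z≤n , period , minimal) ((α + r) Vec.∷ Vec.[]) eq
  where
  p = suc π
  r = proj₁ (reciprocal π)
  pr : ℕ→ℚ p * r ≡ 1ℚ
  pr = proj₂ (proj₂ (reciprocal π))
  u : ℕ → ℚ
  u k = (β - (α + r)) - r * ℕ→ℚ (k DivMod.% p)
  period : ∀ k → u (k ℕ.+ p) ≡ u k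
  period k = cong (λ s → (β - (α + r)) - r * ℕ→ℚ s) (DivMod.[m+n]%n≡m%n k p)
  minimal : ∀ q → 1 ℕ.≤ q → q ℕ.< p → ¬ (∀ k → u (k ℕ.+ q) ≡ u k)
  minimal q 1≤q q<p u≡ = ℕₚ.<⇒≢ 1≤q (sym (ℕₚ.n≤0⇒n≡0 (ℤₚ.drop‿+≤+ (ℤ→ℚ-cancel-≤ {+ q} {+ 0} (ℚₚ.≤-reflexive q≡0)))))
    where
    isolate : ∀ p b r s → p * ((b - r * 0ℚ) - (b - r * s)) ≡ (p * r) * s
    isolate = solve-∀ ℚ-ring
    b = β - (α + r)
    q≡0 : ℕ→ℚ q ≡ 0ℚ
    q≡0 = trans (cong ℕ→ℚ (sym (DivMod.m<n⇒m%n≡m q<p))) (trans (sym (ℚₚ.*-identityˡ (ℕ→ℚ (q DivMod.% p))))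
      (trans (cong (λ s → s * ℕ→ℚ (q DivMod.% p)) (sym pr)) (trans (sym (isolate (ℕ→ℚ p) b r (ℕ→ℚ (q DivMod.% p))))
      (trans (cong (λ s → ℕ→ℚ p * ((b - r * 0ℚ) - s)) (u≡ 0)) (trans (cong (λ s → ℕ→ℚ p * s) (ℚₚ.+-inverseʳ (b - r * 0ℚ))) (ℚₚ.*-zeroʳ (ℕ→ℚ p)))))))
  eq : ∀ k → ℕ→ℚ (k DivMod./ p) + (α * ℕ→ℚ k + β) ≡ u k + ((α + r) * R 1 k + 0ℚ)
  eq k = trans (cong (λ s → s + (α * ℕ→ℚ k + β)) quotient) (trans (collect α β r (ℕ→ℚ k) (ℕ→ℚ (k DivMod.% p))) (cong (λ s → u k + ((α + r) * s + 0ℚ)) (sym (R-1 k))))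
    where
    q = k DivMod./ p
    isolate : ∀ q P r s → q * (P * r) ≡ r * ((s + q * P) - s)
    isolate = solve-∀ ℚ-ring
    pr′ : (1ℚ + ℕ→ℚ π) * r ≡ 1ℚ
    pr′ = trans (cong (λ s → s * r) (sym (ℕ→ℚ-suc π))) pr
    quotient : ℕ→ℚ q ≡ r * (ℕ→ℚ k - ℕ→ℚ (k DivMod.% p))
    quotient = trans (sym (ℚₚ.*-identityʳ (ℕ→ℚ q))) (trans (cong (λ s → ℕ→ℚ q * s) (sym pr′))
      (trans (isolate (ℕ→ℚ q) (1ℚ + ℕ→ℚ π) r (ℕ→ℚ (k DivMod.% p))) (cong (λ s → r * (s - ℕ→ℚ (k DivMod.% p))) (sym (ℕ→ℚ-/ π k)))))
    collect : ∀ α β r k s → r * (k - s) + (α * k + β) ≡ ((β - (α + r)) - r * s) + ((α + r) * (1ℚ + k) + 0ℚ)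
    collect = solve-∀ ℚ-ring

-- From the binomial basis to powers of k

evaluate : ∀ {n} → (Fin n → ℚ) → ℕ → ℚ
evaluate c k = sumℚ (λ i → c i * (ℕ→ℚ k ^ℚ Fin.toℕ i))

evaluate-suc : ∀ {n} (c : Fin (suc n) → ℚ) k → evaluate c k ≡ c zero + ℕ→ℚ k * evaluate (λ i → c (suc i)) k
evaluate-suc c k = cong₂ _+_ (ℚₚ.*-identityʳ (c zero))
  (trans (sumℚ-cong (λ i → commute (c (suc i)) (ℕ→ℚ k) (ℕ→ℚ k ^ℚ Fin.toℕ i))) (sym (*-sumℚ (ℕ→ℚ k) (λ i → c (suc i) * (ℕ→ℚ k ^ℚ Fin.toℕ i)))))
  where
  commute : ∀ c k x → c * (k * x) ≡ k * (c * x)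
  commute = solve-∀ ℚ-ring

Polynomial : ℕ → (ℕ → ℚ) → Set
Polynomial n f = Σ (Fin n → ℚ) λ c → ∀ k → f k ≡ evaluate c k

sumℚ-+ : ∀ {m} (f g : Fin m → ℚ) → sumℚ (λ i → f i + g i) ≡ sumℚ f + sumℚ g
sumℚ-+ {zero} f g = refl
sumℚ-+ {suc m} f g = trans (cong (λ s → f zero + g zero + s) (sumℚ-+ (λ i → f (suc i)) (λ i → g (suc i))))
  (interchange (f zero) (g zero) (sumℚ (λ i → f (suc i))) (sumℚ (λ i → g (suc i))))
  where
  interchange : ∀ a b c d → a + b + (c + d) ≡ a + c + (b + d)
  interchange = solve-∀ ℚ-ring

polynomial-≗ : ∀ {n f g} → (∀ k → g k ≡ f k) → Polynomial n f → Polynomial n g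
polynomial-≗ g≗f (c , eq) = c , λ k → trans (g≗f k) (eq k)

polynomial-+ : ∀ {n f g} → Polynomial n f → Polynomial n g → Polynomial n (λ k → f k + g k)
polynomial-+ (c , f≡) (d , g≡) = (λ i → c i + d i) , λ k → trans (cong₂ _+_ (f≡ k) (g≡ k))
  (trans (sym (sumℚ-+ (λ i → c i * (ℕ→ℚ k ^ℚ Fin.toℕ i)) (λ i → d i * (ℕ→ℚ k ^ℚ Fin.toℕ i))))
         (sumℚ-cong (λ i → sym (ℚₚ.*-distribʳ-+ (ℕ→ℚ k ^ℚ Fin.toℕ i) (c i) (d i)))))

polynomial-* : ∀ {n f} a → Polynomial n f → Polynomial n (λ k → a * f k)
polynomial-* a (c , f≡) = (λ i → a * c i) , λ k → trans (cong (λ s → a * s) (f≡ k))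
  (trans (*-sumℚ a (λ i → c i * (ℕ→ℚ k ^ℚ Fin.toℕ i))) (sumℚ-cong (λ i → sym (ℚₚ.*-assoc a (c i) (ℕ→ℚ k ^ℚ Fin.toℕ i)))))

polynomial-const : ∀ a → Polynomial 1 (λ _ → a)
polynomial-const a = (λ _ → a) , λ k → constant a
  where
  constant : ∀ a → a ≡ a * 1ℚ + 0ℚ
  constant = solve-∀ ℚ-ring

polynomial-shift : ∀ {n f} → Polynomial n f → Polynomial (suc n) (λ k → ℕ→ℚ k * f k)
polynomial-shift {n} {f} (c , f≡) = c′ , λ k → trans (cong (λ s → ℕ→ℚ k * s) (f≡ k))
    (trans (sym (ℚₚ.+-identityˡ (ℕ→ℚ k * evaluate c k))) (sym (evaluate-suc c′ k)))
  where
  c′ : Fin (suc n) → ℚ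
  c′ zero = 0ℚ
  c′ (suc i) = c i

polynomial-raise : ∀ {n f} → Polynomial n f → Polynomial (suc n) f
polynomial-raise (c , f≡) = raise c , λ k → trans (f≡ k) (sym (evaluate-raise c k))
  where
  raise : ∀ {n} → (Fin n → ℚ) → Fin (suc n) → ℚ
  raise {zero} c _ = 0ℚ
  raise {suc n} c zero = c zero
  raise {suc n} c (suc i) = raise (λ i → c (suc i)) i
  evaluate-raise : ∀ {n} (c : Fin n → ℚ) k → evaluate (raise c) k ≡ evaluate c k
  evaluate-raise {zero} c k = refl
  evaluate-raise {suc n} c k = trans (evaluate-suc (raise c) k)
    (trans (cong (λ s → c zero + ℕ→ℚ k * s) (evaluate-raise (λ i → c (suc i)) k)) (sym (evaluate-suc c k)))

polynomial-raise* : ∀ l {n f} → Polynomial n f → Polynomial (l ℕ.+ n) f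
polynomial-raise* zero P = P
polynomial-raise* (suc l) P = polynomial-raise (polynomial-raise* l P)

-- `R-suc` divided by i + 1 expresses `R (suc i)` as k · `R i` / (i + 1) + `R i`.
polynomial-R : ∀ i → Polynomial (suc i) (R i)
polynomial-R zero = polynomial-const 1ℚ
polynomial-R (suc i) = polynomial-≗ solve
  (polynomial-+ (polynomial-* r (polynomial-shift (polynomial-R i)))
                (polynomial-raise (polynomial-R i)))
  where
  r = proj₁ (reciprocal i)
  inv : ℕ→ℚ (suc i) * r ≡ 1ℚ
  inv = proj₂ (proj₂ (reciprocal i))
  solve : ∀ k → R (suc i) k ≡ r * (ℕ→ℚ k * R i k) + R i k
  solve k = trans (scale (R (suc i) k)) (trans (cong (λ s → r * s) (R-suc i k))
      (trans (distribute r (ℕ→ℚ k) (ℕ→ℚ (suc i)) (R i k)) (cong (λ s → r * (ℕ→ℚ k * R i k) + s) (sym (scale (R i k))))))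
    where
    scale : ∀ x → x ≡ r * (ℕ→ℚ (suc i) * x)
    scale x = trans (sym (ℚₚ.*-identityˡ x)) (trans (cong (λ s → s * x) (trans (sym inv) (ℚₚ.*-comm (ℕ→ℚ (suc i)) r))) (ℚₚ.*-assoc r (ℕ→ℚ (suc i)) x))
    distribute : ∀ r k i x → r * ((k + i) * x) ≡ r * (k * x) + r * (i * x)
    distribute = solve-∀ ℚ-ring

polynomial-expand : ∀ {l} i (gs : Vec ℚ l) → Polynomial (l ℕ.+ i) (expand i gs)
polynomial-expand i Vec.[] = (λ _ → 0ℚ) , λ k → sym (trans (sumℚ-cong (λ j → ℚₚ.*-zeroˡ (ℕ→ℚ k ^ℚ Fin.toℕ {i} j))) (zeros i))
  where
  zeros : ∀ n → sumℚ {n} (λ _ → 0ℚ) ≡ 0ℚ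
  zeros zero = refl
  zeros (suc n) = cong (λ s → 0ℚ + s) (zeros n)
polynomial-expand {suc l} i (g Vec.∷ gs) = subst (λ n → Polynomial n (expand i (g Vec.∷ gs))) (ℕₚ.+-suc l i)
  (polynomial-+ (polynomial-raise* l (polynomial-* g (polynomial-R i))) (polynomial-expand (suc i) gs))

-- Finite sums of natural numbers and of floors

sumℕ-cong : ∀ n {f g} → (∀ a → a ℕ.< n → f a ≡ g a) → sumℕ n f ≡ sumℕ n g
sumℕ-cong zero f≗g = refl
sumℕ-cong (suc n) f≗g = cong₂ ℕ._+_ (sumℕ-cong n (λ a a<n → f≗g a (ℕₚ.m<n⇒m<1+n a<n))) (f≗g n ℕₚ.≤-refl)

sumℕ-+ : ∀ n f g → sumℕ n (λ a → f a ℕ.+ g a) ≡ sumℕ n f ℕ.+ sumℕ n g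
sumℕ-+ zero f g = refl
sumℕ-+ (suc n) f g = trans (cong (λ s → s ℕ.+ (f n ℕ.+ g n)) (sumℕ-+ n f g)) (interchange (sumℕ n f) (sumℕ n g) (f n) (g n))
  where
  interchange : ∀ a b c d → a ℕ.+ b ℕ.+ (c ℕ.+ d) ≡ a ℕ.+ c ℕ.+ (b ℕ.+ d)
  interchange = ring-ℕ

sumℕ-* : ∀ n c f → sumℕ n (λ a → c ℕ.* f a) ≡ c ℕ.* sumℕ n f
sumℕ-* zero c f = sym (ℕₚ.*-zeroʳ c)
sumℕ-* (suc n) c f = trans (cong (λ s → s ℕ.+ c ℕ.* f n) (sumℕ-* n c f)) (sym (ℕₚ.*-distribˡ-+ c (sumℕ n f) (f n)))

sumℕ-const : ∀ n c → sumℕ n (λ _ → c) ≡ n ℕ.* c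
sumℕ-const zero c = refl
sumℕ-const (suc n) c = trans (cong (λ s → s ℕ.+ c) (sumℕ-const n c)) (ℕₚ.+-comm (n ℕ.* c) c)

sumℕ-first : ∀ n f → sumℕ (suc n) f ≡ f 0 ℕ.+ sumℕ n (λ a → f (suc a))
sumℕ-first zero f = ℕₚ.+-comm 0 (f 0)
sumℕ-first (suc n) f = trans (cong (λ s → s ℕ.+ f (suc n)) (sumℕ-first n f)) (ℕₚ.+-assoc (f 0) _ (f (suc n)))

sumℕ-reverse : ∀ n f → sumℕ (suc n) (λ a → f (n ∸ a)) ≡ sumℕ (suc n) f
sumℕ-reverse zero f = refl
sumℕ-reverse (suc n) f = trans (sumℕ-first (suc n) (λ a → f (suc n ∸ a)))
  (trans (cong (λ s → f (suc n) ℕ.+ s) (sumℕ-reverse n f)) (ℕₚ.+-comm (f (suc n)) (sumℕ (suc n) f)))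

sumℕ-split : ∀ m n f → sumℕ (m ℕ.+ n) f ≡ sumℕ m f ℕ.+ sumℕ n (λ a → f (m ℕ.+ a))
sumℕ-split m zero f = trans (cong (λ s → sumℕ s f) (ℕₚ.+-identityʳ m)) (sym (ℕₚ.+-identityʳ (sumℕ m f)))
sumℕ-split m (suc n) f = trans (cong (λ s → sumℕ s f) (ℕₚ.+-suc m n))
  (trans (cong (λ s → s ℕ.+ f (m ℕ.+ n)) (sumℕ-split m n f)) (ℕₚ.+-assoc (sumℕ m f) _ (f (m ℕ.+ n))))

S-sumℕ : ∀ (f : ℕ → ℕ) k → ℕ→ℚ (sumℕ (suc k) f) ≡ S (λ a → ℕ→ℚ (f a)) k
S-sumℕ f zero = refl
S-sumℕ f (suc k) = trans (ℕ→ℚ-+ (sumℕ (suc k) f) (f (suc k))) (cong (λ s → s + ℕ→ℚ (f (suc k))) (S-sumℕ f k))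

triangle : ℕ → ℕ
triangle n = sumℕ n (λ a → a)

triangle-ℚ : ∀ n → ℕ→ℚ (triangle n) ≡ ℚ.½ * (ℕ→ℚ n * (ℕ→ℚ n - 1ℚ))
triangle-ℚ zero = refl
triangle-ℚ (suc n) = trans (ℕ→ℚ-+ (triangle n) n) (trans (cong (λ s → s + ℕ→ℚ n) (triangle-ℚ n))
  (trans (cong (λ s → ℚ.½ * (ℕ→ℚ n * (ℕ→ℚ n - 1ℚ)) + s) (sym (ℚₚ.*-identityˡ (ℕ→ℚ n))))
  (trans (step ℚ.½ (ℕ→ℚ n)) (cong (λ s → ℚ.½ * (s * (s - 1ℚ))) (sym (ℕ→ℚ-suc n))))))
  where
  step : ∀ h n → h * (n * (n - 1ℚ)) + (h + h) * n ≡ h * ((1ℚ + n) * (1ℚ + n - 1ℚ))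
  step = solve-∀ ℚ-ring

-- Over each block of 1 + δ consecutive arguments the floor is constant.
sumℕ-floor : ∀ δ j → sumℕ (j ℕ.* suc δ) (λ a → a DivMod./ suc δ) ≡ suc δ ℕ.* triangle j
sumℕ-floor δ zero = sym (ℕₚ.*-zeroʳ (suc δ))
sumℕ-floor δ (suc j) = trans (cong (λ s → sumℕ s (λ a → a DivMod./ suc δ)) (ℕₚ.+-comm (suc δ) (j ℕ.* suc δ)))
  (trans (sumℕ-split (j ℕ.* suc δ) (suc δ) (λ a → a DivMod./ suc δ))
  (trans (cong₂ ℕ._+_ (sumℕ-floor δ j) (trans (sumℕ-cong (suc δ) block) (sumℕ-const (suc δ) j)))
         (sym (ℕₚ.*-distribˡ-+ (suc δ) (triangle j) j))))
  where
  block : ∀ a → a ℕ.< suc δ → (j ℕ.* suc δ ℕ.+ a) DivMod./ suc δ ≡ j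
  block a a<D = trans (DivMod.+-distrib-/-∣ˡ {j ℕ.* suc δ} a (n∣m*n j))
    (trans (cong₂ ℕ._+_ (DivMod.m*n/n≡m j (suc δ)) (DivMod.m<n⇒m/n≡0 a<D)) (ℕₚ.+-identityʳ j))

S-linear : ∀ α β k → S (λ a → α * ℕ→ℚ a + β) k ≡ α * (ℚ.½ * (ℕ→ℚ k * (ℕ→ℚ k + 1ℚ))) + β * (ℕ→ℚ k + 1ℚ)
S-linear α β zero = base α β ℚ.½
  where
  base : ∀ α β h → α * 0ℚ + β ≡ α * (h * (0ℚ * (0ℚ + 1ℚ))) + β * (0ℚ + 1ℚ)
  base = solve-∀ ℚ-ring
S-linear α β (suc k) = trans (cong₂ _+_ (S-linear α β k) (cong (λ s → α * s + β) (ℕ→ℚ-suc k)))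
  (trans (step α β (ℕ→ℚ k)) (cong (λ s → α * (ℚ.½ * (s * (s + 1ℚ))) + β * (s + 1ℚ)) (sym (ℕ→ℚ-suc k))))
  where
  step′ : ∀ α β h k → α * (h * (k * (k + 1ℚ))) + β * (k + 1ℚ) + (α * ((h + h) * (1ℚ + k)) + β) ≡
    α * (h * ((1ℚ + k) * (1ℚ + k + 1ℚ))) + β * (1ℚ + k + 1ℚ)
  step′ = solve-∀ ℚ-ring
  step : ∀ α β k → α * (ℚ.½ * (k * (k + 1ℚ))) + β * (k + 1ℚ) + (α * (1ℚ + k) + β) ≡
    α * (ℚ.½ * ((1ℚ + k) * (1ℚ + k + 1ℚ))) + β * (1ℚ + k + 1ℚ)
  step α β k = trans (cong (λ s → α * (ℚ.½ * (k * (k + 1ℚ))) + β * (k + 1ℚ) + (α * s + β)) (sym (ℚₚ.*-identityˡ (1ℚ + k)))) (step′ α β ℚ.½ k)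

-- Lattice points of the dilates

module Lattice (π δ : ℕ) (η ε : ℚ) (0≤η : 0ℚ ≤ η) (0≤ε : 0ℚ ≤ ε)
  (η-inv : (1ℚ + ℕ→ℚ π) * η ≡ 1ℚ) (ε-inv : (1ℚ + ℕ→ℚ δ) * ε ≡ 1ℚ)
  where
  open Geometry (ℕ→ℚ π) η (ℕ→ℚ δ) ε (ℕ→ℚ-nonneg π) 0≤η (ℕ→ℚ-nonneg δ) 0≤ε η-inv ε-inv

  -- The lowest lattice point of a column is at -lo and the highest at hi; a numbers the columns
  -- within a strip. In `rightHi` the slope 1/p₁ - 1 is split into an integer fall by a and a floor
  -- that continues the one in `leftHi` from argument j on.
  leftLo leftHi rightHi : ℕ → ℕ → ℕ
  leftLo  j a = a ℕ.+ (j ∸ a) DivMod./ suc π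
  leftHi  j a = δ ℕ.* j ℕ.+ a DivMod./ suc δ
  rightHi j a = (δ ℕ.* j ∸ a) ℕ.+ (j ℕ.+ a) DivMod./ suc δ

  midHi : ℕ → ℕ
  midHi j = δ ℕ.* j ℕ.+ j DivMod./ suc δ

  baseCount : ℕ → ℕ → ℕ
  baseCount e j = sumℕ j (λ a → suc (leftLo j a ℕ.+ leftHi j a))
    ℕ.+ (sumℕ (e ℕ.+ j) (λ _ → suc (j ℕ.+ midHi j))
    ℕ.+ sumℕ (suc (δ ℕ.* j)) (λ a → suc (j ℕ.+ rightHi j a)))

  private
    -- hi = M + ⌊N / (1 + δ)⌋ is the largest integer y with (1 + δ) (M − y) + N ≥ 0.
    ≤hi⇒ : ∀ M N {y} → 0ℚ ≤ ℕ→ℚ (M ℕ.+ N DivMod./ suc δ) - y → 0ℚ ≤ (1ℚ + ℕ→ℚ δ) * (ℕ→ℚ M - y) + ℕ→ℚ N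
    ≤hi⇒ M N {y} h = floor≤ δ N (y - ℕ→ℚ M) (h by trans (eq (ℕ→ℚ q) (ℕ→ℚ M) y) (cong (λ s → s - y) (sym (ℕ→ℚ-+ M q))))
      by cong (λ s → (1ℚ + ℕ→ℚ δ) * s + ℕ→ℚ N) (flip (ℕ→ℚ M) y)
      where
      q = N DivMod./ suc δ
      eq : ∀ q M y → q - (y - M) ≡ M + q - y
      eq = solve-∀ ℚ-ring
      flip : ∀ M y → M - y ≡ - (y - M)
      flip = solve-∀ ℚ-ring

    ⇒≤hi : ∀ M N (y : ℤ) → 0ℚ ≤ (1ℚ + ℕ→ℚ δ) * (ℕ→ℚ M - ℤ→ℚ y) + ℕ→ℚ N → 0ℚ ≤ ℕ→ℚ (M ℕ.+ N DivMod./ suc δ) - ℤ→ℚ y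
    ⇒≤hi M N y h = ≤floor δ N (y ℤ.+ ℤ.- + M) (h by cong (λ s → (1ℚ + ℕ→ℚ δ) * s + ℕ→ℚ N) (trans (cong -_ cast) (sym (flip (ℕ→ℚ M) (ℤ→ℚ y)))))
      by trans (cong (λ s → s - ℤ→ℚ y) (ℕ→ℚ-+ M q)) (trans (sym (eq (ℕ→ℚ q) (ℕ→ℚ M) (ℤ→ℚ y))) (cong (λ s → ℕ→ℚ q - s) (sym cast)))
      where
      q = N DivMod./ suc δ
      cast : ℤ→ℚ (y ℤ.+ ℤ.- + M) ≡ ℤ→ℚ y - ℕ→ℚ M
      cast = trans (ℤ→ℚ-+ y (ℤ.- + M)) (cong (λ s → ℤ→ℚ y + s) (ℤ→ℚ-neg (+ M)))
      eq : ∀ q M y → q - (y - M) ≡ M + q - y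
      eq = solve-∀ ℚ-ring
      flip : ∀ M y → M - y ≡ - (y - M)
      flip = solve-∀ ℚ-ring

    lo≤⇒ : ∀ a N {y} → 0ℚ ≤ y + ℕ→ℚ (a ℕ.+ N DivMod./ suc π) → 0ℚ ≤ (1ℚ + ℕ→ℚ π) * (y + ℕ→ℚ a) + ℕ→ℚ N
    lo≤⇒ a N {y} h = floor≤ π N (- (y + ℕ→ℚ a)) (h by trans (eq (ℕ→ℚ q) (ℕ→ℚ a) y) (cong (λ s → y + s) (sym (ℕ→ℚ-+ a q))))
      by cong (λ s → (1ℚ + ℕ→ℚ π) * s + ℕ→ℚ N) (flip (ℕ→ℚ a) y)
      where
      q = N DivMod./ suc π
      eq : ∀ q a y → q - (- (y + a)) ≡ y + (a + q)
      eq = solve-∀ ℚ-ring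
      flip : ∀ a y → y + a ≡ - (- (y + a))
      flip = solve-∀ ℚ-ring

    ⇒lo≤ : ∀ a N (y : ℤ) → 0ℚ ≤ (1ℚ + ℕ→ℚ π) * (ℤ→ℚ y + ℕ→ℚ a) + ℕ→ℚ N → 0ℚ ≤ ℤ→ℚ y + ℕ→ℚ (a ℕ.+ N DivMod./ suc π)
    ⇒lo≤ a N y h = ≤floor π N (ℤ.- (y ℤ.+ + a)) (h by cong (λ s → (1ℚ + ℕ→ℚ π) * s + ℕ→ℚ N) (trans (cong -_ cast) (sym (flip (ℕ→ℚ a) (ℤ→ℚ y)))))
      by trans (cong (λ s → ℤ→ℚ y + s) (ℕ→ℚ-+ a q)) (trans (sym (eq (ℕ→ℚ q) (ℕ→ℚ a) (ℤ→ℚ y))) (cong (λ s → ℕ→ℚ q - s) (sym cast)))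
      where
      q = N DivMod./ suc π
      cast : ℤ→ℚ (ℤ.- (y ℤ.+ + a)) ≡ - (ℤ→ℚ y + ℕ→ℚ a)
      cast = trans (ℤ→ℚ-neg (y ℤ.+ + a)) (cong -_ (ℤ→ℚ-+ y (+ a)))
      eq : ∀ q a y → q - (- (y + a)) ≡ y + (a + q)
      eq = solve-∀ ℚ-ring
      flip : ∀ a y → y + a ≡ - (- (y + a))
      flip = solve-∀ ℚ-ring

  InBase : ℕ → ℕ → ℕ → ZPt 1 → Set
  InBase e j x z = BaseRegion (ℕ→ℚ e) (ℕ→ℚ j) (ℕ→ℚ x) (ℤ→ℚ (z zero))

  private
    assoc- : ∀ a b c → a + b - c ≡ a + (b - c)
    assoc- = solve-∀ ℚ-ring

  module _ (e j : ℕ) (z : ZPt 1) where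
    private
      y = ℤ→ℚ (z zero)
      0≤e = ℕ→ℚ-nonneg e
      0≤j = ℕ→ℚ-nonneg j

    left⇒base : ∀ a → a ℕ.< j → Between (leftLo j a) (leftHi j a) z → InBase e j a z
    left⇒base a a<j (lo≤y , y≤hi) = left-strip 0≤e 0≤j (ℕ→ℚ-nonneg a) (≤⇒0≤- (ℕ→ℚ-mono-≤ a≤j))
      (lo≤⇒ a (j ∸ a) {y} lo≤y by trans (assoc- ((1ℚ + ℕ→ℚ π) * (y + ℕ→ℚ a)) (ℕ→ℚ j) (ℕ→ℚ a)) (cong (λ s → (1ℚ + ℕ→ℚ π) * (y + ℕ→ℚ a) + s) (sym (ℕ→ℚ-∸ a≤j))))
      (≤hi⇒ (δ ℕ.* j) a y≤hi by cong (λ s → (1ℚ + ℕ→ℚ δ) * (s - y) + ℕ→ℚ a) (sym (ℕ→ℚ-* δ j)))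
      where
      a≤j : a ℕ.≤ j
      a≤j = ℕₚ.<⇒≤ a<j

    base⇒left : ∀ a → a ℕ.< j → InBase e j a z → Between (leftLo j a) (leftHi j a) z
    base⇒left a a<j R =
        ⇒lo≤ a (j ∸ a) (z zero) (R .lower-left by trans (cong (λ s → (1ℚ + ℕ→ℚ π) * (y + ℕ→ℚ a) + s) (ℕ→ℚ-∸ (ℕₚ.<⇒≤ a<j))) (sym (assoc- ((1ℚ + ℕ→ℚ π) * (y + ℕ→ℚ a)) (ℕ→ℚ j) (ℕ→ℚ a))))
      , ⇒≤hi (δ ℕ.* j) a (z zero) (R .upper-left by cong (λ s → (1ℚ + ℕ→ℚ δ) * (s - y) + ℕ→ℚ a) (ℕ→ℚ-* δ j))
      where open BaseRegion

    mid⇒base : ∀ a → a ℕ.< e ℕ.+ j → Between j (midHi j) z → InBase e j (j ℕ.+ a) z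
    mid⇒base a a<e+j (lo≤y , y≤hi) = mid-strip 0≤j
      (ℕ→ℚ-nonneg a by trans (cong (λ s → s - ℕ→ℚ j) (ℕ→ℚ-+ j a)) (after (ℕ→ℚ j) (ℕ→ℚ a)))
      (≤⇒0≤- (ℕ→ℚ-mono-≤ (ℕₚ.<⇒≤ a<e+j)) by trans (cong (λ s → ℕ→ℚ j + ℕ→ℚ j + ℕ→ℚ e - s) (ℕ→ℚ-+ j a))
         (trans (before (ℕ→ℚ e) (ℕ→ℚ j) (ℕ→ℚ a)) (cong (λ s → s - ℕ→ℚ a) (sym (ℕ→ℚ-+ e j)))))
      lo≤y
      (≤hi⇒ (δ ℕ.* j) j y≤hi by cong (λ s → (1ℚ + ℕ→ℚ δ) * (s - y) + ℕ→ℚ j) (sym (ℕ→ℚ-* δ j)))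
      where
      after : ∀ j a → j + a - j ≡ a
      after = solve-∀ ℚ-ring
      before : ∀ e j a → j + j + e - (j + a) ≡ e + j - a
      before = solve-∀ ℚ-ring

    base⇒mid : ∀ x → InBase e j x z → Between j (midHi j) z
    base⇒mid x R = R .lower
                 , ⇒≤hi (δ ℕ.* j) j (z zero) (R .upper by cong (λ s → (1ℚ + ℕ→ℚ δ) * (s - y) + ℕ→ℚ j) (ℕ→ℚ-* δ j))
      where open BaseRegion

    private
      x-2j-e : ∀ a → ℕ→ℚ (j ℕ.+ j ℕ.+ e ℕ.+ a) - (ℕ→ℚ j + ℕ→ℚ j + ℕ→ℚ e) ≡ ℕ→ℚ a
      x-2j-e a = trans (cong (λ s → s - (ℕ→ℚ j + ℕ→ℚ j + ℕ→ℚ e)) (ℕ→ℚ-+ (j ℕ.+ j ℕ.+ e) a))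
        (trans (cong (λ s → s + ℕ→ℚ a - (ℕ→ℚ j + ℕ→ℚ j + ℕ→ℚ e)) (trans (ℕ→ℚ-+ (j ℕ.+ j) e) (cong (λ s → s + ℕ→ℚ e) (ℕ→ℚ-+ j j))))
               (cancel (ℕ→ℚ j + ℕ→ℚ j + ℕ→ℚ e) (ℕ→ℚ a)))
        where
        cancel : ∀ s a → s + a - s ≡ a
        cancel = solve-∀ ℚ-ring

      right-end : ∀ a → ℕ→ℚ e + (1ℚ + 1ℚ + ℕ→ℚ δ) * ℕ→ℚ j - ℕ→ℚ (j ℕ.+ j ℕ.+ e ℕ.+ a) ≡ ℕ→ℚ (δ ℕ.* j) - ℕ→ℚ a
      right-end a = trans (split (ℕ→ℚ e) (ℕ→ℚ j) (ℕ→ℚ δ) (ℕ→ℚ (j ℕ.+ j ℕ.+ e ℕ.+ a))) (cong₂ _-_ (sym (ℕ→ℚ-* δ j)) (x-2j-e a))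
        where
        split : ∀ e j δ x → e + (1ℚ + 1ℚ + δ) * j - x ≡ δ * j - (x - (j + j + e))
        split = solve-∀ ℚ-ring

      -- This is the shear: δa = (1 + δ)a - a, and the multiple of 1 + δ moves into the bracket as
      -- an integer shift of y.
      right-top : ∀ a → a ℕ.≤ δ ℕ.* j → (1ℚ + ℕ→ℚ δ) * (ℕ→ℚ δ * ℕ→ℚ j - y) + ℕ→ℚ j - ℕ→ℚ δ * (ℕ→ℚ (j ℕ.+ j ℕ.+ e ℕ.+ a) - (ℕ→ℚ j + ℕ→ℚ j + ℕ→ℚ e))
        ≡ (1ℚ + ℕ→ℚ δ) * (ℕ→ℚ (δ ℕ.* j ∸ a) - y) + ℕ→ℚ (j ℕ.+ a)
      right-top a a≤δj = trans (cong (λ s → (1ℚ + ℕ→ℚ δ) * (ℕ→ℚ δ * ℕ→ℚ j - y) + ℕ→ℚ j - ℕ→ℚ δ * s) (x-2j-e a))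
        (trans (shear (ℕ→ℚ δ) (ℕ→ℚ j) y (ℕ→ℚ a))
          (sym (cong₂ (λ s t → (1ℚ + ℕ→ℚ δ) * (s - y) + t)
            (trans (ℕ→ℚ-∸ a≤δj) (cong (λ s → s - ℕ→ℚ a) (ℕ→ℚ-* δ j))) (ℕ→ℚ-+ j a))))
        where
        shear : ∀ δ j y a → (1ℚ + δ) * (δ * j - y) + j - δ * a ≡ (1ℚ + δ) * (δ * j - a - y) + (j + a)
        shear = solve-∀ ℚ-ring

    right⇒base : ∀ a → a ℕ.< suc (δ ℕ.* j) → Between j (rightHi j a) z → InBase e j (j ℕ.+ j ℕ.+ e ℕ.+ a) z
    right⇒base a a<1+δj (lo≤y , y≤hi) = right-strip 0≤e 0≤j
      (ℕ→ℚ-nonneg a by x-2j-e a)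
      (≤⇒0≤- (ℕ→ℚ-mono-≤ a≤δj) by right-end a)
      lo≤y
      (≤hi⇒ (δ ℕ.* j ∸ a) (j ℕ.+ a) y≤hi by right-top a a≤δj)
      where
      a≤δj : a ℕ.≤ δ ℕ.* j
      a≤δj = ℕₚ.m<1+n⇒m≤n a<1+δj

    base⇒right : ∀ a → InBase e j (j ℕ.+ j ℕ.+ e ℕ.+ a) z → a ℕ.< suc (δ ℕ.* j) × Between j (rightHi j a) z
    base⇒right a R = ℕ.s≤s a≤δj , R .lower , ⇒≤hi (δ ℕ.* j ∸ a) (j ℕ.+ a) (z zero) (R .upper-right by sym (right-top a a≤δj))
      where
      open BaseRegion
      a≤δj : a ℕ.≤ δ ℕ.* j
      a≤δj = ℕ→ℚ-cancel-≤ (0≤-⇒≤ (R .right by sym (right-end a)))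

  LatticeRegion : ∀ m → ℕ → ℕ → ZPt (suc (suc m)) → Set
  LatticeRegion m e j z = Region m (ℕ→ℚ e) (ℕ→ℚ j) (λ c → ℤ→ℚ (z c))

  -- The strips are taken half-open, so the columns x = j and x = 2j + e that two strips share are
  -- counted once; only the last strip includes its right end.
  counted-base : ∀ e j → Counted (LatticeRegion 0 e j) (baseCount e j)
  counted-base e j = counted-⇔ to from
    (counted-∪ (counted-fibres (λ a → Between (leftLo j a) (leftHi j a)) _ 0 j (λ a _ → counted-between (leftLo j a) (leftHi j a)))
    (counted-∪ (counted-fibres (λ _ → Between j (midHi j)) _ j (e ℕ.+ j) (λ _ _ → counted-between j (midHi j)))
               (counted-fibres (λ a → Between j (rightHi j a)) _ (j ℕ.+ j ℕ.+ e) (suc (δ ℕ.* j)) (λ a _ → counted-between j (rightHi j a)))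
               mid-right) left-other)
    where
    Left Mid Right : ZPt 2 → Set
    Left z = ∃ λ a → a ℕ.< j × z zero ≡ + (0 ℕ.+ a) × Between (leftLo j a) (leftHi j a) (tail z)
    Mid z = ∃ λ a → a ℕ.< e ℕ.+ j × z zero ≡ + (j ℕ.+ a) × Between j (midHi j) (tail z)
    Right z = ∃ λ a → a ℕ.< suc (δ ℕ.* j) × z zero ≡ + (j ℕ.+ j ℕ.+ e ℕ.+ a) × Between j (rightHi j a) (tail z)

    at : ∀ {x} z → z zero ≡ + x → InBase e j x (tail z) → LatticeRegion 0 e j z
    at z eq R = subst (λ x → BaseRegion (ℕ→ℚ e) (ℕ→ℚ j) (ℤ→ℚ x) (ℤ→ℚ (z (suc zero)))) (sym eq) R

    to : ∀ z → Left z ⊎ Mid z ⊎ Right z → LatticeRegion 0 e j z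
    to z (inj₁ (a , a< , eq , b)) = at z eq (left⇒base e j (tail z) a a< b)
    to z (inj₂ (inj₁ (a , a< , eq , b))) = at z eq (mid⇒base e j (tail z) a a< b)
    to z (inj₂ (inj₂ (a , a< , eq , b))) = at z eq (right⇒base e j (tail z) a a< b)

    locate : ∀ z x → z zero ≡ + x → InBase e j x (tail z) → x ℕ.< j ⊎ j ℕ.≤ x → x ℕ.< j ℕ.+ j ℕ.+ e ⊎ j ℕ.+ j ℕ.+ e ℕ.≤ x →
      Left z ⊎ Mid z ⊎ Right z
    locate z x eq R (inj₁ x<j) _ = inj₁ (x , x<j , eq , base⇒left e j (tail z) x x<j R)
    locate z x eq R (inj₂ j≤x) (inj₁ x<2j+e) = inj₂ (inj₁ (x ∸ j , offset< , trans eq (cong +_ (sym x≡)) , base⇒mid e j (tail z) x R))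
      where
      x≡ : j ℕ.+ (x ∸ j) ≡ x
      x≡ = ℕₚ.m+[n∸m]≡n j≤x
      offset< : x ∸ j ℕ.< e ℕ.+ j
      offset< = ℕₚ.+-cancelˡ-< j _ _ (subst₂ ℕ._<_ (sym x≡) (trans (ℕₚ.+-assoc j j e) (cong (λ s → j ℕ.+ s) (ℕₚ.+-comm j e))) x<2j+e)
    locate z x eq R (inj₂ _) (inj₂ 2j+e≤x) = inj₂ (inj₂ (x ∸ (j ℕ.+ j ℕ.+ e) , proj₁ found , trans eq (cong +_ (sym x≡)) , proj₂ found))
      where
      x≡ : j ℕ.+ j ℕ.+ e ℕ.+ (x ∸ (j ℕ.+ j ℕ.+ e)) ≡ x
      x≡ = ℕₚ.m+[n∸m]≡n 2j+e≤x
      found : x ∸ (j ℕ.+ j ℕ.+ e) ℕ.< suc (δ ℕ.* j) × Between j (rightHi j (x ∸ (j ℕ.+ j ℕ.+ e))) (tail z)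
      found = base⇒right e j (tail z) (x ∸ (j ℕ.+ j ℕ.+ e)) (subst (λ x → InBase e j x (tail z)) (sym x≡) R)

    from : ∀ z → LatticeRegion 0 e j z → Left z ⊎ Mid z ⊎ Right z
    from z R = locate z x eq (subst (λ x → BaseRegion (ℕ→ℚ e) (ℕ→ℚ j) (ℤ→ℚ x) (ℤ→ℚ (z (suc zero)))) eq R)
        (ℕₚ.<-≤-connex x j) (ℕₚ.<-≤-connex x (j ℕ.+ j ℕ.+ e))
      where
      natural : ∃ λ x → z zero ≡ + x
      natural = nonneg-ℤ {z zero} (BaseRegion.left R)
      x : ℕ
      x = proj₁ natural
      eq : z zero ≡ + x
      eq = proj₂ natural

    mid-right : ∀ z w → Mid z → Right w → ¬ z ≗ᶻ w
    mid-right z w (a , a< , z≡ , _) (b , _ , w≡ , _) eq = ℕₚ.<⇒≢ (begin-strict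
      j ℕ.+ a               <⟨ ℕₚ.+-monoʳ-< j a< ⟩
      j ℕ.+ (e ℕ.+ j)       ≡⟨ trans (cong (λ s → j ℕ.+ s) (ℕₚ.+-comm e j)) (sym (ℕₚ.+-assoc j j e)) ⟩
      j ℕ.+ j ℕ.+ e         ≤⟨ ℕₚ.m≤m+n _ b ⟩
      j ℕ.+ j ℕ.+ e ℕ.+ b   ∎) (ℤₚ.+-injective (trans (sym z≡) (trans (eq zero) w≡)))
      where open ℕₚ.≤-Reasoning

    left-other : ∀ z w → Left z → Mid w ⊎ Right w → ¬ z ≗ᶻ w
    left-other z w (a , a<j , z≡ , _) (inj₁ (b , _ , w≡ , _)) eq =
      ℕₚ.<⇒≢ (ℕₚ.<-≤-trans a<j (ℕₚ.m≤m+n j b)) (ℤₚ.+-injective (trans (sym z≡) (trans (eq zero) w≡)))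
    left-other z w (a , a<j , z≡ , _) (inj₂ (b , _ , w≡ , _)) eq =
      ℕₚ.<⇒≢ (ℕₚ.<-≤-trans a<j (ℕₚ.≤-trans (ℕₚ.m≤m+n j (j ℕ.+ e ℕ.+ b)) (ℕₚ.≤-reflexive assoc))) (ℤₚ.+-injective (trans (sym z≡) (trans (eq zero) w≡)))
      where
      assoc : j ℕ.+ (j ℕ.+ e ℕ.+ b) ≡ j ℕ.+ j ℕ.+ e ℕ.+ b
      assoc = trans (sym (ℕₚ.+-assoc j (j ℕ.+ e) b)) (cong (λ s → s ℕ.+ b) (sym (ℕₚ.+-assoc j j e)))

  count : ℕ → ℕ → ℕ → ℕ
  count zero    e j = baseCount e j
  count (suc m) e j = sumℕ (suc j) (λ a → count m (e ℕ.+ a) (j ∸ a))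

  counted-region : ∀ m e j → Counted (LatticeRegion m e j) (count m e j)
  counted-region zero e j = counted-base e j
  counted-region (suc m) e j = counted-⇔ to from
    (counted-fibres (λ a → LatticeRegion m (e ℕ.+ a) (j ∸ a)) (λ a → count m (e ℕ.+ a) (j ∸ a)) 0 (suc j)
                    (λ a _ → counted-region m (e ℕ.+ a) (j ∸ a)))
    where
    Fibres : ZPt (suc (suc (suc m))) → Set
    Fibres z = ∃ λ a → a ℕ.< suc j × z zero ≡ + a × LatticeRegion m (e ℕ.+ a) (j ∸ a) (tail z)

    to : ∀ z → Fibres z → LatticeRegion (suc m) e j z
    to z (a , a<1+j , z₀≡a , R) =
        (ℕ→ℚ-nonneg a by cong ℤ→ℚ z₀≡a)
      , (≤⇒0≤- (ℕ→ℚ-mono-≤ a≤j) by cong (λ s → ℕ→ℚ j - ℤ→ℚ s) z₀≡a)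
      , subst₂ (λ s t → Region m s t (λ c → ℤ→ℚ (z (suc c))))
          (trans (ℕ→ℚ-+ e a) (cong (λ s → ℕ→ℚ e + ℤ→ℚ s) (sym z₀≡a)))
          (trans (ℕ→ℚ-∸ a≤j) (cong (λ s → ℕ→ℚ j - ℤ→ℚ s) (sym z₀≡a))) R
      where
      a≤j : a ℕ.≤ j
      a≤j = ℕₚ.m<1+n⇒m≤n a<1+j

    from : ∀ z → LatticeRegion (suc m) e j z → Fibres z
    from z (0≤z₀ , z₀≤j , R) = a , ℕ.s≤s a≤j , z₀≡a , subst₂ (λ s t → Region m s t (λ c → ℤ→ℚ (z (suc c))))
        (trans (cong (λ s → ℕ→ℚ e + ℤ→ℚ s) z₀≡a) (sym (ℕ→ℚ-+ e a)))
        (trans (cong (λ s → ℕ→ℚ j - ℤ→ℚ s) z₀≡a) (sym (ℕ→ℚ-∸ a≤j))) R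
      where
      natural : ∃ λ a → z zero ≡ + a
      natural = nonneg-ℤ {z zero} 0≤z₀
      a : ℕ
      a = proj₁ natural
      z₀≡a : z zero ≡ + a
      z₀≡a = proj₂ natural
      a≤j : a ℕ.≤ j
      a≤j = ℕ→ℚ-cancel-≤ (0≤-⇒≤ (z₀≤j by cong (λ s → ℕ→ℚ j - ℤ→ℚ s) (sym z₀≡a)))

  -- Separating the two periods

  sideCount midCount : ℕ → ℕ → ℕ
  sideCount zero    j = sumℕ j (λ a → suc (leftLo j a ℕ.+ leftHi j a)) ℕ.+ sumℕ (suc (δ ℕ.* j)) (λ a → suc (j ℕ.+ rightHi j a))
  sideCount (suc m) j = sumℕ (suc j) (sideCount m)
  midCount zero    j = suc (j ℕ.+ midHi j)
  midCount (suc m) j = sumℕ (suc j) (midCount m)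

  -- Slicing replaces e and j by e + a and j - a, with the same sum. The factor e + j is thus
  -- constant over the slices and can be taken out, and what is left are partial sums of the two
  -- counts.
  count-split : ∀ m e j → count m e j ≡ sideCount m j ℕ.+ (e ℕ.+ j) ℕ.* midCount m j
  count-split zero e j = trans (cong (λ s → lefts ℕ.+ (s ℕ.+ rights)) (sumℕ-const (e ℕ.+ j) (midCount 0 j)))
                                   (swap lefts ((e ℕ.+ j) ℕ.* midCount 0 j) rights)
    where
    lefts rights : ℕ
    lefts = sumℕ j (λ a → suc (leftLo j a ℕ.+ leftHi j a))
    rights = sumℕ (suc (δ ℕ.* j)) (λ a → suc (j ℕ.+ rightHi j a))
    swap : ∀ a b c → a ℕ.+ (b ℕ.+ c) ≡ a ℕ.+ c ℕ.+ b
    swap = ring-ℕ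
  count-split (suc m) e j =
    trans (sumℕ-cong (suc j) (λ a a<1+j → trans (count-split m (e ℕ.+ a) (j ∸ a))
      (cong (λ s → sideCount m (j ∸ a) ℕ.+ s ℕ.* midCount m (j ∸ a)) (dilate a (ℕₚ.m<1+n⇒m≤n a<1+j)))))
    (trans (sumℕ-reverse j (λ b → sideCount m b ℕ.+ (e ℕ.+ j) ℕ.* midCount m b))
    (trans (sumℕ-+ (suc j) (sideCount m) (λ b → (e ℕ.+ j) ℕ.* midCount m b))
           (cong (λ s → sideCount (suc m) j ℕ.+ s) (sumℕ-* (suc j) (e ℕ.+ j) (midCount m)))))
    where
    dilate : ∀ a → a ℕ.≤ j → e ℕ.+ a ℕ.+ (j ∸ a) ≡ e ℕ.+ j
    dilate a a≤j = trans (ℕₚ.+-assoc e a (j ∸ a)) (cong (λ s → e ℕ.+ s) (ℕₚ.m+[n∸m]≡n a≤j))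

  midCount-quasiPoly : ∀ m → QuasiPoly (suc δ) (suc m) (λ k → ℕ→ℚ (midCount m k))
  midCount-quasiPoly zero = quasiPoly-≗ linear (quasiPoly-floor δ (1ℚ + ℕ→ℚ δ) 1ℚ)
    where
    linear : ∀ k → ℕ→ℚ (midCount 0 k) ≡ ℕ→ℚ (k DivMod./ suc δ) + ((1ℚ + ℕ→ℚ δ) * ℕ→ℚ k + 1ℚ)
    linear k = trans (ℕ→ℚ-suc (k ℕ.+ midHi k)) (trans (cong (λ s → 1ℚ + s) (trans (ℕ→ℚ-+ k (midHi k))
      (cong (λ s → ℕ→ℚ k + s) (trans (ℕ→ℚ-+ (δ ℕ.* k) q) (cong (λ s → s + ℕ→ℚ q) (ℕ→ℚ-* δ k))))))
      (regroup (ℕ→ℚ k) (ℕ→ℚ δ) (ℕ→ℚ q)))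
      where
      q = k DivMod./ suc δ
      regroup : ∀ k δ q → 1ℚ + (k + (δ * k + q)) ≡ q + ((1ℚ + δ) * k + 1ℚ)
      regroup = solve-∀ ℚ-ring
  midCount-quasiPoly (suc m) = quasiPoly-≗ (S-sumℕ (midCount m)) (quasiPoly-S (midCount-quasiPoly m))

  private
    -- The three groups are the floor-free terms of the left columns, the joined floors with
    -- denominator p₁, and the floor-free terms of the right columns.
    quadratic : ℕ → ℕ
    quadratic j = (j ℕ.* suc (δ ℕ.* j) ℕ.+ triangle j) ℕ.+ (suc δ ℕ.* triangle j ℕ.+ j)
      ℕ.+ (suc (δ ℕ.* j) ℕ.* suc j ℕ.+ (triangle (δ ℕ.* j) ℕ.+ δ ℕ.* j))

    -- The floors from the left and the right columns join into one sum over 0 ≤ a ≤ (1 + δ) j: this is why p₁ does not affect them.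
    sideCount-0 : ∀ j → sideCount 0 j ≡ sumℕ (suc j) (λ a → a DivMod./ suc π) ℕ.+ quadratic j
    sideCount-0 j = trans (cong₂ ℕ._+_ left right)
      (trans (regroup (j ℕ.* suc (δ ℕ.* j) ℕ.+ triangle j) floors (sumℕ j fl) (suc (δ ℕ.* j) ℕ.* suc j) (triangle (δ ℕ.* j) ℕ.+ δ ℕ.* j) (sumℕ (suc (δ ℕ.* j)) (λ a → fl (j ℕ.+ a))))
             (cong (λ s → floors ℕ.+ ((j ℕ.* suc (δ ℕ.* j) ℕ.+ triangle j) ℕ.+ s ℕ.+ (suc (δ ℕ.* j) ℕ.* suc j ℕ.+ (triangle (δ ℕ.* j) ℕ.+ δ ℕ.* j)))) joined))
      where
      fl : ℕ → ℕ
      fl a = a DivMod./ suc δ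
      floors = sumℕ (suc j) (λ a → a DivMod./ suc π)
      regroup : ∀ a p b c d f → (a ℕ.+ p ℕ.+ b) ℕ.+ (c ℕ.+ d ℕ.+ f) ≡ p ℕ.+ (a ℕ.+ (b ℕ.+ f) ℕ.+ (c ℕ.+ d))
      regroup = ring-ℕ
      joined : sumℕ j fl ℕ.+ sumℕ (suc (δ ℕ.* j)) (λ a → fl (j ℕ.+ a)) ≡ suc δ ℕ.* triangle j ℕ.+ j
      -- The final argument (1 + δ) j comes after the full blocks and contributes j.
      joined = trans (sym (sumℕ-split j (suc (δ ℕ.* j)) fl))
        (trans (cong (λ n → sumℕ n fl) (length j δ)) (cong₂ ℕ._+_ (sumℕ-floor δ j) (DivMod.m*n/n≡m j (suc δ))))
        where
        length : ∀ j δ → j ℕ.+ suc (δ ℕ.* j) ≡ suc (j ℕ.* suc δ)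
        length = ring-ℕ
      left : sumℕ j (λ a → suc (leftLo j a ℕ.+ leftHi j a)) ≡ (j ℕ.* suc (δ ℕ.* j) ℕ.+ triangle j) ℕ.+ floors ℕ.+ sumℕ j fl
      left = trans (sumℕ-cong j (λ a _ → arrange a ((j ∸ a) DivMod./ suc π) (δ ℕ.* j) (fl a)))
        (trans (sumℕ-+ j (λ a → suc (δ ℕ.* j) ℕ.+ a ℕ.+ (j ∸ a) DivMod./ suc π) fl) (cong (λ s → s ℕ.+ sumℕ j fl)
        (trans (sumℕ-+ j (λ a → suc (δ ℕ.* j) ℕ.+ a) (λ a → (j ∸ a) DivMod./ suc π))
        (cong₂ ℕ._+_ (trans (sumℕ-+ j (λ _ → suc (δ ℕ.* j)) (λ a → a)) (cong (λ s → s ℕ.+ triangle j) (sumℕ-const j (suc (δ ℕ.* j))))) reversed))))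
        where
        arrange : ∀ a p d q → suc (a ℕ.+ p ℕ.+ (d ℕ.+ q)) ≡ suc d ℕ.+ a ℕ.+ p ℕ.+ q
        arrange = ring-ℕ
        reversed : sumℕ j (λ a → (j ∸ a) DivMod./ suc π) ≡ floors
        -- The sum over a < j lacks the term a = j that the reversal needs; its floor is ⌊0/p₀⌋ = 0.
        reversed = trans (trans (sym (ℕₚ.+-identityʳ _)) (cong (λ s → sumℕ j (λ a → (j ∸ a) DivMod./ suc π) ℕ.+ s DivMod./ suc π) (sym (ℕₚ.n∸n≡0 j))))
          (sumℕ-reverse j (λ a → a DivMod./ suc π))
      right : sumℕ (suc (δ ℕ.* j)) (λ a → suc (j ℕ.+ rightHi j a)) ≡
        suc (δ ℕ.* j) ℕ.* suc j ℕ.+ (triangle (δ ℕ.* j) ℕ.+ δ ℕ.* j) ℕ.+ sumℕ (suc (δ ℕ.* j)) (λ a → fl (j ℕ.+ a))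
      right = trans (sumℕ-cong (suc (δ ℕ.* j)) (λ a _ → arrange j (δ ℕ.* j ∸ a) (fl (j ℕ.+ a))))
        (trans (sumℕ-+ (suc (δ ℕ.* j)) (λ a → suc j ℕ.+ (δ ℕ.* j ∸ a)) (λ a → fl (j ℕ.+ a)))
        (cong (λ s → s ℕ.+ sumℕ (suc (δ ℕ.* j)) (λ a → fl (j ℕ.+ a)))
        (trans (sumℕ-+ (suc (δ ℕ.* j)) (λ _ → suc j) (λ a → δ ℕ.* j ∸ a))
        (cong₂ ℕ._+_ (sumℕ-const (suc (δ ℕ.* j)) (suc j)) (sumℕ-reverse (δ ℕ.* j) (λ a → a))))))
        where
        arrange : ∀ j d q → suc (j ℕ.+ (d ℕ.+ q)) ≡ suc j ℕ.+ d ℕ.+ q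
        arrange = ring-ℕ

    -- Found by comparing coefficients: `quadratic` has leading coefficient α/2, linear coefficient
    -- α/2 + β and value 1 at 0. As a partial sum of a linear function plus a constant, it can share
    -- one `S` with the floors ⌊a/p₀⌋.
    α β : ℚ
    α = 1ℚ + 1ℚ + (1ℚ + 1ℚ + 1ℚ + 1ℚ + 1ℚ) * ℕ→ℚ δ + ℕ→ℚ δ * ℕ→ℚ δ
    β = ℚ.½ * (1ℚ + 1ℚ - (1ℚ + 1ℚ + 1ℚ) * ℕ→ℚ δ - ℕ→ℚ δ * ℕ→ℚ δ)

    quadratic-S : ∀ j → ℕ→ℚ (quadratic j) ≡ S (λ a → α * ℕ→ℚ a + β) j + (1ℚ - β)
    quadratic-S j = trans cast (trans (cong (λ s → ℚ.½ * (J * (J - 1ℚ)) + ((1ℚ + D) * (ℚ.½ * (J * (J - 1ℚ)))) + ℚ.½ * (D * J * (D * J - 1ℚ)) + s)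
        (sym (ℚₚ.*-identityˡ (J * (1ℚ + D * J) + J + (1ℚ + D * J) * (1ℚ + J) + D * J))))
      (trans (complete ℚ.½ J D) (cong (λ s → s + (1ℚ - β)) (sym (S-linear α β j)))))
      where
      J = ℕ→ℚ j
      D = ℕ→ℚ δ
      regroup : ∀ J D T T′ → (J * (1ℚ + D * J) + T) + ((1ℚ + D) * T + J) + ((1ℚ + D * J) * (1ℚ + J) + (T′ + D * J)) ≡
        T + ((1ℚ + D) * T) + T′ + (J * (1ℚ + D * J) + J + (1ℚ + D * J) * (1ℚ + J) + D * J)
      regroup = solve-∀ ℚ-ring
      δj : ℕ→ℚ (δ ℕ.* j) ≡ D * J
      δj = ℕ→ℚ-* δ j
      1+δj : ℕ→ℚ (suc (δ ℕ.* j)) ≡ 1ℚ + D * J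
      1+δj = trans (ℕ→ℚ-suc (δ ℕ.* j)) (cong (λ s → 1ℚ + s) δj)
      homo-+ : ∀ a b {x y} → ℕ→ℚ a ≡ x → ℕ→ℚ b ≡ y → ℕ→ℚ (a ℕ.+ b) ≡ x + y
      homo-+ a b eq eq′ = trans (ℕ→ℚ-+ a b) (cong₂ _+_ eq eq′)
      homo-* : ∀ a b {x y} → ℕ→ℚ a ≡ x → ℕ→ℚ b ≡ y → ℕ→ℚ (a ℕ.* b) ≡ x * y
      homo-* a b eq eq′ = trans (ℕ→ℚ-* a b) (cong₂ _*_ eq eq′)
      T T′ : ℚ
      T = ℚ.½ * (J * (J - 1ℚ))
      T′ = ℚ.½ * (D * J * (D * J - 1ℚ))
      cast : ℕ→ℚ (quadratic j) ≡ T + ((1ℚ + D) * T) + T′ + (J * (1ℚ + D * J) + J + (1ℚ + D * J) * (1ℚ + J) + D * J)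
      cast = trans (homo-+ (j ℕ.* suc (δ ℕ.* j) ℕ.+ triangle j ℕ.+ (suc δ ℕ.* triangle j ℕ.+ j)) (suc (δ ℕ.* j) ℕ.* suc j ℕ.+ (triangle (δ ℕ.* j) ℕ.+ δ ℕ.* j))
          (homo-+ (j ℕ.* suc (δ ℕ.* j) ℕ.+ triangle j) (suc δ ℕ.* triangle j ℕ.+ j)
            (homo-+ (j ℕ.* suc (δ ℕ.* j)) (triangle j) (homo-* j (suc (δ ℕ.* j)) refl 1+δj) (triangle-ℚ j))
            (homo-+ (suc δ ℕ.* triangle j) j (homo-* (suc δ) (triangle j) (ℕ→ℚ-suc δ) (triangle-ℚ j)) refl))
          (homo-+ (suc (δ ℕ.* j) ℕ.* suc j) (triangle (δ ℕ.* j) ℕ.+ δ ℕ.* j)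
            (homo-* (suc (δ ℕ.* j)) (suc j) 1+δj (ℕ→ℚ-suc j))
            (homo-+ (triangle (δ ℕ.* j)) (δ ℕ.* j) (trans (triangle-ℚ (δ ℕ.* j)) (cong (λ s → ℚ.½ * (s * (s - 1ℚ))) δj)) δj)))
        (regroup J D T T′)
      complete : ∀ h J D → let α = 1ℚ + 1ℚ + (1ℚ + 1ℚ + 1ℚ + 1ℚ + 1ℚ) * D + D * D
                               β = h * (1ℚ + 1ℚ - (1ℚ + 1ℚ + 1ℚ) * D - D * D) in
        h * (J * (J - 1ℚ)) + ((1ℚ + D) * (h * (J * (J - 1ℚ)))) + h * (D * J * (D * J - 1ℚ))
          + (h + h) * (J * (1ℚ + D * J) + J + (1ℚ + D * J) * (1ℚ + J) + D * J)
        ≡ α * (h * (J * (J + 1ℚ))) + β * (J + 1ℚ) + ((h + h) - β)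
      complete = solve-∀ ℚ-ring

  sideCount-quasiPoly : ∀ m → QuasiPoly (suc π) (suc (suc m)) (λ k → ℕ→ℚ (sideCount m k))
  sideCount-quasiPoly zero = quasiPoly-≗ eq (quasiPoly-+const (1ℚ - β) (quasiPoly-S (quasiPoly-floor π α β)))
    where
    eq : ∀ k → ℕ→ℚ (sideCount 0 k) ≡ S (λ a → ℕ→ℚ (a DivMod./ suc π) + (α * ℕ→ℚ a + β)) k + (1ℚ - β)
    eq k = trans (cong ℕ→ℚ (sideCount-0 k)) (trans (ℕ→ℚ-+ (sumℕ (suc k) (λ a → a DivMod./ suc π)) (quadratic k))
      (trans (cong₂ _+_ (S-sumℕ (λ a → a DivMod./ suc π) k) (quadratic-S k))
      (trans (sym (ℚₚ.+-assoc (S (λ a → ℕ→ℚ (a DivMod./ suc π)) k) (S (λ a → α * ℕ→ℚ a + β) k) (1ℚ - β)))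
             (cong (λ s → s + (1ℚ - β)) (sym (S-+ (λ a → ℕ→ℚ (a DivMod./ suc π)) (λ a → α * ℕ→ℚ a + β) k))))))
  sideCount-quasiPoly (suc m) = quasiPoly-≗ (S-sumℕ (sideCount m)) (quasiPoly-S (sideCount-quasiPoly m))

-- The Ehrhart coefficients and their periods

module PeriodSequence (m π δ : ℕ) (η ε : ℚ) (0≤η : 0ℚ ≤ η) (0≤ε : 0ℚ ≤ ε)
  (η-inv : (1ℚ + ℕ→ℚ π) * η ≡ 1ℚ) (ε-inv : (1ℚ + ℕ→ℚ δ) * ε ≡ 1ℚ)
  where
  open Geometry (ℕ→ℚ π) η (ℕ→ℚ δ) ε (ℕ→ℚ-nonneg π) 0≤η (ℕ→ℚ-nonneg δ) 0≤ε η-inv ε-inv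
  open Lattice π δ η ε 0≤η 0≤ε η-inv ε-inv
  open QuasiPoly (sideCount-quasiPoly m) renaming (periodic to u; minPeriod to u-minPeriod; coeffs to gs; decompose to side≡)
  open QuasiPoly (midCount-quasiPoly m) renaming (periodic to v; minPeriod to v-minPeriod; coeffs to hs; decompose to mid≡)

  -- The polynomial parts of both counts are converted to powers of k together. The two lowest
  -- coefficients then only add constants to the periodic functions u and v, which keeps their
  -- minimum periods.
  constants : Polynomial (suc (suc (suc m))) (λ k → expand 1 gs k + ℕ→ℚ k * expand 1 hs k)
  constants = polynomial-+
    (subst (λ n → Polynomial n (expand 1 gs)) (ℕₚ.+-comm (suc (suc m)) 1) (polynomial-expand 1 gs))
    (polynomial-shift (subst (λ n → Polynomial n (expand 1 hs)) (ℕₚ.+-comm (suc m) 1) (polynomial-expand 1 hs)))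

  a : Fin (suc (suc (suc m))) → ℚ
  a = proj₁ constants

  c : Fin (suc (suc (suc m))) → ℤ → ℚ
  c zero            = extend (suc π) (λ k → u k + a zero)
  c (suc zero)      = extend (suc δ) (λ k → v k + a (suc zero))
  c (suc (suc i)) _ = a (suc (suc i))

  periods : PeriodSeq01 c (suc π) (suc δ)
  periods = extend-minPeriod (minPeriodℕ-+const (a zero) u-minPeriod)
          , λ { zero    → extend-minPeriod (minPeriodℕ-+const (a (suc zero)) v-minPeriod)
              ; (suc i) → ℕ.s≤s ℕ.z≤n , (λ _ → refl) , λ q 1≤q q<1 _ → ℕₚ.<⇒≱ q<1 1≤q }

  ehrhart : EhrhartQP (𝒫 m) c
  ehrhart k 1≤k = count m 0 k
    , counted-⇔ (λ z → region⇒inDilate m k 1≤k) (λ z → inDilate⇒region m k) (counted-region m 0 k)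
    -- For e = 0 the factor e + j is k itself, so v becomes part of the linear coefficient and u of
    -- the constant one.
    , trans (cong ℕ→ℚ (count-split m 0 k))
     (trans (ℕ→ℚ-+ (sideCount m k) (k ℕ.* midCount m k))
     (trans (cong₂ _+_ (side≡ k) (trans (ℕ→ℚ-* k (midCount m k)) (cong (λ s → ℕ→ℚ k * s) (mid≡ k))))
     (trans (separate (u k) (expand 1 gs k) (ℕ→ℚ k) (v k) (expand 1 hs k))
     (trans (cong (λ s → u k + ℕ→ℚ k * v k + s) (proj₂ constants k))
            (absorb (u k) (ℕ→ℚ k) (v k) (a zero) (a (suc zero)) (sumℚ (λ i → a (suc (suc i)) * (ℕ→ℚ k ^ℚ Fin.toℕ (Fin.suc (Fin.suc i))))))))))
    where
    separate : ∀ u g k v h → u + g + k * (v + h) ≡ u + k * v + (g + k * h)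
    separate = solve-∀ ℚ-ring
    absorb : ∀ u k v a₀ a₁ r → u + k * v + (a₀ * 1ℚ + (a₁ * (k * 1ℚ) + r)) ≡ (u + a₀) * 1ℚ + ((v + a₁) * (k * 1ℚ) + r)
    absorb = solve-∀ ℚ-ring

  result : Σ (RatPolytope (suc (suc m))) λ P → FullDim P ×
    Σ (Fin (suc (suc (suc m))) → ℤ → ℚ) λ c → EhrhartQP P c × PeriodSeq01 c (suc π) (suc δ)
  result = 𝒫 m , 𝒫-fullDim m , c , ehrhart , periods

theorem1 : (n : ℕ) → 2 ℕ.≤ n → (p₀ p₁ : ℕ) → 1 ℕ.≤ p₀ → 1 ℕ.≤ p₁ →
    Σ (RatPolytope n) λ P → FullDim P ×
      Σ (Fin (suc n) → ℤ → ℚ) λ c → EhrhartQP P c × PeriodSeq01 c p₀ p₁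
theorem1 (suc zero) (ℕ.s≤s ()) _ _ _ _
theorem1 (suc (suc m)) _ (suc π) (suc δ) _ _ =
  PeriodSequence.result m π δ (proj₁ (reciprocal π)) (proj₁ (reciprocal δ))
    (proj₁ (proj₂ (reciprocal π))) (proj₁ (proj₂ (reciprocal δ))) (inverse π) (inverse δ)
  where
  inverse : ∀ a → (1ℚ + ℕ→ℚ a) * proj₁ (reciprocal a) ≡ 1ℚ
  inverse a = trans (cong (λ s → s * proj₁ (reciprocal a)) (sym (ℕ→ℚ-suc a))) (proj₂ (proj₂ (reciprocal a)))
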